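{- Let $d \equiv 2 \pmod 4$ be a square-free positive integer such that both equations $x^2 - dy^2 = -1$ and $x^2 - dy^2 = 6$ have solutions in integers $x, y$. Let $n = (4m+2) + 4k\sqrt{d}$ with $m, k \in \mathbb{Z}$, and suppose that $(m,k)$ satisfies neither ($m \equiv 9 \pmod{12}$ and $k \equiv 3 \pmod 6$) nor ($m \equiv 0 \pmod{12}$ and $k \equiv 0 \pmod 6$). Then there exist infinitely many $D(n)$-quadruples in $\mathbb{Z}[\sqrt{d}]$.
   Context: For $n \in \mathbb{Z}[\sqrt{d}]$, a set $\{a_1,a_2,a_3,a_4\}$ of four distinct non-zero elements of $\mathbb{Z}[\sqrt{d}]$ is called a $D(n)$-quadruple in $\mathbb{Z}[\sqrt{d}]$ if $a_ia_j + n$ is a square of an element of $\mathbb{Z}[\sqrt{d}]$ for all $1 \le i < j \le 4$. -}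

module Defs where

open import Data.Fin.Base as Fin using (Fin)
open import Data.Integer.Base using (ℤ; +_; 0ℤ; _+_; _*_; _-_)
open import Data.Integer.Divisibility.Signed using (_∣_)
open import Data.Nat.Base as ℕ using (ℕ)
import Data.Nat.Divisibility as ℕ
open import Data.Product.Base using (∃)
open import Function.Bundles using (Injection)
open import Function.Definitions using (Injective)
open import Level using (Level; 0ℓ; _⊔_)
open import Relation.Binary.Bundles using (Setoid)
import Relation.Binary.Construct.On as On
open import Relation.Binary.PropositionalEquality using (_≡_; _≢_; setoid)
open import Relation.Unary using (Pred)
open import Relation.Unary.Relation.Binary.Equality using (≐-setoid)

infix 4 _≡_[mod_]

_≡_[mod_] : ℤ → ℤ → ℕ → Set
a ≡ b [mod n ] = + n ∣ a - b

SquareFree : ℕ → Set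
SquareFree n = ∀ p → p ℕ.* p ℕ.∣ n → p ≡ 1

infix  5 _+√d·_

-- a +√d· b is the element a + b√d.  Propositional equality on ℤ[√ d ] is
-- equality of coordinates, so the record models the subring ℤ[√d] of ℝ
-- only when d is not a perfect square.  The parameter d is used by _⊗_.
record ℤ[√_] (d : ℕ) : Set where
  constructor _+√d·_
  field
    re im : ℤ

module _ {d : ℕ} where

  infixl 7 _⊗_
  infixl 6 _⊕_

  𝟘 : ℤ[√ d ]
  𝟘 = 0ℤ +√d· 0ℤ

  _⊕_ : ℤ[√ d ] → ℤ[√ d ] → ℤ[√ d ]
  (a +√d· b) ⊕ (a′ +√d· b′) = a + a′ +√d· b + b′

  _⊗_ : ℤ[√ d ] → ℤ[√ d ] → ℤ[√ d ]
  (a +√d· b) ⊗ (a′ +√d· b′) = a * a′ + + d * (b * b′) +√d· a * b′ + b * a′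

  IsSquare : ℤ[√ d ] → Set
  IsSquare z = ∃ λ w → w ⊗ w ≡ z

  -- An enumeration a₁, a₂, a₃, a₄ of a D(n)-quadruple; two enumerations of the
  -- same set are identified in DQuadrupleSetoid below.
  record DQuadruple (n : ℤ[√ d ]) : Set where
    field
      elem     : Fin 4 → ℤ[√ d ]
      distinct : Injective _≡_ _≡_ elem
      nonZero  : ∀ i → elem i ≢ 𝟘
      square   : ∀ i j → i Fin.< j → IsSquare (elem i ⊗ elem j ⊕ n)

    set : Pred ℤ[√ d ] 0ℓ
    set z = ∃ λ i → elem i ≡ z

  DQuadrupleSetoid : ℤ[√ d ] → Setoid 0ℓ 0ℓ
  DQuadrupleSetoid n = On.setoid (≐-setoid ℤ[√ d ] 0ℓ) (DQuadruple.set {n})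

-- Dedekind infinite: there is a sequence of pairwise inequivalent elements.
Infinite : ∀ {a ℓ : Level} → Setoid a ℓ → Set (a ⊔ ℓ)
Infinite S = Injection (setoid ℕ) S

{-# OPTIONS --safe #-}

-- If a b + n = r², then {a, b, a + b + 2 r, a + 4 b + 4 r} is a D(n)-quadruple
-- as soon as T² − 3 n is a square, where T = a + 2 r.  Such T come from
-- factorizations 3 n = s t, as T = (s + t) / 2.  Since 6 divides 3 n, so does
-- every s of norm ± 6, and the Pell units provide infinitely many of them.  For a
-- fixed, it remains to make T − a divisible by 2 and r² − n divisible by a.
-- According to (m , k) modulo (4 , 2), the choices a = 2, a = 4 or a of norm ± 6
-- achieve this; the last one needs r² ≡ n modulo a prime over 3, which is possible
-- unless m and k are both divisible by 3.

module Submission where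

open import Algebra.Bundles using (CommutativeRing)
import Algebra.Solver.Ring as RingSolver
open import Algebra.Solver.Ring.AlmostCommutativeRing
  using (AlmostCommutativeRing; fromCommutativeRing; _-Raw-AlmostCommutative⟶_)
open import Data.Fin.Base as Fin using (Fin)
open import Data.Fin.Patterns using (0F; 1F; 2F; 3F)
import Data.Fin.Properties as Fin
open import Data.Integer.Base using (ℤ; +_; -_; -[1+_]; _+_; _*_; _-_; _^_; 0ℤ; 1ℤ; ∣_∣)
open import Data.Integer.DivMod using (_%ℕ_; _/ℕ_; n%ℕd<d; a≡a%ℕn+[a/ℕn]*n)
open import Data.Integer.Divisibility.Signed
  using (_∣_; _∣?_; divides; ∣⇒∣ᵤ; ∣ᵤ⇒∣; ∣-refl; ∣m∣n⇒∣m+n; ∣m∣n⇒∣m-n; ∣m⇒∣m*n)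
open import Data.Integer.Properties as ℤ using (∣i+j∣≤∣i∣+∣j∣; abs-*; ∣-i∣≡∣i∣)
open import Data.Integer.Tactic.RingSolver using (solve-∀)
open import Data.Maybe.Base using (Maybe; just; nothing)
open import Data.Nat.Base as ℕ using (ℕ; zero; suc; z≤n; s≤s)
import Data.Nat.Divisibility as ℕ
open import Data.Nat.Primality using (prime?; euclidsLemma)
import Data.Nat.Properties as ℕ
open import Data.Nat.Tactic.RingSolver using () renaming (solve-∀ to ℕ-solve-∀)
open import Data.Product.Base using (_,_; ∃; ∃₂; proj₁; proj₂; _×_)
open import Data.Sum.Base as Sum using (_⊎_; inj₁; inj₂)
open import Function.Base using (_∘_)
open import Function.Definitions using (Injective)
open import Level using (0ℓ)
open import Relation.Binary.Bundles using (Setoid)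
open import Relation.Binary.Definitions using (tri<; tri≈; tri>)
open import Relation.Binary.PropositionalEquality
open import Relation.Nullary.Decidable using (True; from-no; from-yes; no; toWitness; yes)
open import Relation.Nullary.Negation using (¬_; contradiction)
open import Defs
open ℤ[√_]

-- The two Pell equations force d ≡ 10 modulo 24, and both factors of 24 matter. Modulo 8, an
-- element p + q√d of norm 6 has p ≡ 0 modulo 4, one of norm -6 has p ≡ 2, and q is odd in either
-- case. The sign of the norm of s therefore controls T modulo 4, and the class of (m , k) tells
-- which sign to use. As -n arises from (-m - 1 , -k), one computation with a sign e serves both.
-- Modulo 3, d is a square, so there are two primes above 3, the kernels of √d ↦ 1 and √d ↦ -1.
-- Putting a and s in the same prime makes r computable there: r² ≡ n fails at the first prime
-- exactly when 3 ∣ m + k. Conjugation moves the problem to the other prime, with m - k for m + k,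
-- so both fail only if 3 divides m and k. In the classes m ≡ 1 modulo 4, k odd and m ≡ 0 modulo 4,
-- k even, which are the ones left to this choice of a, these are the two excluded pairs. Infinitude
-- and distinctness both rest on size: with a fixed, every coincidence among the four elements
-- bounds T.

module _ {d : ℕ} where

  infix 8 ⊝_

  ⊝_ : ℤ[√ d ] → ℤ[√ d ]
  ⊝ (a +√d· b) = - a +√d· - b

  fromℤ : ℤ → ℤ[√ d ]
  fromℤ c = c +√d· 0ℤ

  #_ : ℕ → ℤ[√ d ]
  # c = fromℤ (+ c)

  conj : ℤ[√ d ] → ℤ[√ d ]
  conj (a +√d· b) = a +√d· - b

  norm : ℤ[√ d ] → ℤ
  norm (a +√d· b) = a * a - + d * (b * b)

  ext : {z w : ℤ[√ d ]} → re z ≡ re w → im z ≡ im w → z ≡ w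
  ext = cong₂ _+√d·_

-- The ring structure and a polynomial solver

ℤ[√]-commutativeRing : ℕ → CommutativeRing 0ℓ 0ℓ
ℤ[√]-commutativeRing d = record
  { Carrier = ℤ[√ d ]
  ; _≈_ = _≡_
  ; _+_ = _⊕_
  ; _*_ = _⊗_
  ; -_ = ⊝_
  ; 0# = 𝟘
  ; 1# = fromℤ 1ℤ
  ; isCommutativeRing = record
    { isRing = record
      { +-isAbelianGroup = record
        { isGroup = record
          { isMonoid = record
            { isSemigroup = record
              { isMagma = record { isEquivalence = isEquivalence ; ∙-cong = cong₂ _⊕_ }
              ; assoc = λ x y z → ext (ℤ.+-assoc (re x) (re y) (re z)) (ℤ.+-assoc (im x) (im y) (im z))
              }
            ; identity = (λ x → ext (ℤ.+-identityˡ (re x)) (ℤ.+-identityˡ (im x))) , (λ x → ext (ℤ.+-identityʳ (re x)) (ℤ.+-identityʳ (im x)))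
            }
          ; inverse = (λ x → ext (ℤ.+-inverseˡ (re x)) (ℤ.+-inverseˡ (im x))) , (λ x → ext (ℤ.+-inverseʳ (re x)) (ℤ.+-inverseʳ (im x)))
          ; ⁻¹-cong = cong ⊝_
          }
        ; comm = λ x y → ext (ℤ.+-comm (re x) (re y)) (ℤ.+-comm (im x) (im y))
        }
      ; *-cong = cong₂ _⊗_
      ; *-assoc = λ (a +√d· b) (c +√d· e) (f +√d· g) → ext (assoc-re (+ d) a b c e f g) (assoc-im (+ d) a b c e f g)
      ; *-identity = (λ (a +√d· b) → ext (idˡ-re (+ d) a b) (idˡ-im a b)) , (λ (a +√d· b) → ext (idʳ-re (+ d) a b) (idʳ-im a b))
      ; distrib = (λ (a +√d· b) (c +√d· e) (f +√d· g) → ext (distribˡ-re (+ d) a b c e f g) (distribˡ-im a b c e f g))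
                , (λ (a +√d· b) (c +√d· e) (f +√d· g) → ext (distribʳ-re (+ d) a b c e f g) (distribʳ-im a b c e f g))
      }
    ; *-comm = λ (a +√d· b) (c +√d· e) → ext (comm-re (+ d) a b c e) (comm-im a b c e)
    }
  }
  where
  assoc-re : ∀ d a b c e f g → (a * c + d * (b * e)) * f + d * ((a * e + b * c) * g) ≡
                                a * (c * f + d * (e * g)) + d * (b * (c * g + e * f))
  assoc-re = solve-∀
  assoc-im : ∀ d a b c e f g → (a * c + d * (b * e)) * g + (a * e + b * c) * f ≡
                                a * (c * g + e * f) + b * (c * f + d * (e * g))
  assoc-im = solve-∀
  idˡ-re : ∀ d a b → 1ℤ * a + d * (0ℤ * b) ≡ a
  idˡ-re = solve-∀
  idˡ-im : ∀ a b → 1ℤ * b + 0ℤ * a ≡ b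
  idˡ-im = solve-∀
  idʳ-re : ∀ d a b → a * 1ℤ + d * (b * 0ℤ) ≡ a
  idʳ-re = solve-∀
  idʳ-im : ∀ a b → a * 0ℤ + b * 1ℤ ≡ b
  idʳ-im = solve-∀
  distribˡ-re : ∀ d a b c e f g → a * (c + f) + d * (b * (e + g)) ≡ (a * c + d * (b * e)) + (a * f + d * (b * g))
  distribˡ-re = solve-∀
  distribˡ-im : ∀ a b c e f g → a * (e + g) + b * (c + f) ≡ (a * e + b * c) + (a * g + b * f)
  distribˡ-im = solve-∀
  distribʳ-re : ∀ d a b c e f g → (c + f) * a + d * ((e + g) * b) ≡ (c * a + d * (e * b)) + (f * a + d * (g * b))
  distribʳ-re = solve-∀
  distribʳ-im : ∀ a b c e f g → (c + f) * b + (e + g) * a ≡ (c * b + e * a) + (f * b + g * a)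
  distribʳ-im = solve-∀
  comm-re : ∀ d a b c e → a * c + d * (b * e) ≡ c * a + d * (e * b)
  comm-re = solve-∀
  comm-im : ∀ a b c e → a * e + b * c ≡ c * b + e * a
  comm-im = solve-∀

-- Coefficients are integers rather than elements of the ring: their products compute although d is
-- a variable, and `fromℤ` sends them to the constants in use.
module ℤ[√]-Solver {d : ℕ} where
  ring : AlmostCommutativeRing 0ℓ 0ℓ
  ring = fromCommutativeRing (ℤ[√]-commutativeRing d)

  fromℤ-homomorphism : CommutativeRing.rawRing ℤ.+-*-commutativeRing -Raw-AlmostCommutative⟶ ring
  fromℤ-homomorphism = record
    { ⟦_⟧ = fromℤ
    ; +-homo = λ _ _ → refl
    ; *-homo = λ a b → ext (re-homo (+ d) a b) (im-homo a b)
    ; -‿homo = λ _ → refl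
    ; 0-homo = refl
    ; 1-homo = refl
    }
    where
    re-homo : ∀ d a b → a * b ≡ a * b + d * (0ℤ * 0ℤ)
    re-homo = solve-∀
    im-homo : ∀ a b → 0ℤ ≡ a * 0ℤ + 0ℤ * b
    im-homo = solve-∀

  fromℤ-≟ : ∀ a b → Maybe (fromℤ {d} a ≡ fromℤ b)
  fromℤ-≟ a b with a ℤ.≟ b
  ... | yes a≡b = just (cong fromℤ a≡b)
  ... | no _ = nothing

  open RingSolver _ ring fromℤ-homomorphism fromℤ-≟ public

-- Heights

i*i≡+∣i∣*∣i∣ : ∀ i → i * i ≡ + (∣ i ∣ ℕ.* ∣ i ∣)
i*i≡+∣i∣*∣i∣ (+ n) = sym (ℤ.pos-* n n)
i*i≡+∣i∣*∣i∣ -[1+ n ] = refl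

m≤m*m : ∀ m → m ℕ.≤ m ℕ.* m
m≤m*m zero = z≤n
m≤m*m (suc m) = ℕ.m≤m*n (suc m) (suc m)

module _ {d : ℕ} where

  -- Size is measured on coordinates because a real absolute value can be small for large
  -- coordinates, as for the inverse of a large unit. Conjugation leaves the height unchanged.
  height : ℤ[√ d ] → ℕ
  height (a +√d· b) = ∣ a ∣ ℕ.+ ∣ b ∣

  height-⊕ : ∀ z w → height (z ⊕ w) ℕ.≤ height z ℕ.+ height w
  height-⊕ (a +√d· b) (a′ +√d· b′) = begin
    ∣ a + a′ ∣ ℕ.+ ∣ b + b′ ∣                        ≤⟨ ℕ.+-mono-≤ (∣i+j∣≤∣i∣+∣j∣ a a′) (∣i+j∣≤∣i∣+∣j∣ b b′) ⟩
    (∣ a ∣ ℕ.+ ∣ a′ ∣) ℕ.+ (∣ b ∣ ℕ.+ ∣ b′ ∣)        ≡⟨ interchange (∣ a ∣) (∣ a′ ∣) (∣ b ∣) (∣ b′ ∣) ⟩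
    (∣ a ∣ ℕ.+ ∣ b ∣) ℕ.+ (∣ a′ ∣ ℕ.+ ∣ b′ ∣)        ∎
    where
    open ℕ.≤-Reasoning
    interchange : ∀ x y z w → (x ℕ.+ y) ℕ.+ (z ℕ.+ w) ≡ (x ℕ.+ z) ℕ.+ (y ℕ.+ w)
    interchange = ℕ-solve-∀

  height-⊝ : ∀ z → height (⊝ z) ≡ height z
  height-⊝ (a +√d· b) = cong₂ ℕ._+_ (∣-i∣≡∣i∣ a) (∣-i∣≡∣i∣ b)

  height-fromℤ-⊗ : ∀ c z → height (fromℤ c ⊗ z) ≡ ∣ c ∣ ℕ.* height z
  height-fromℤ-⊗ c (a +√d· b) = begin
    ∣ c * a + + d * (0ℤ * b) ∣ ℕ.+ ∣ c * b + 0ℤ * a ∣  ≡⟨ cong₂ (λ x y → ∣ x ∣ ℕ.+ ∣ y ∣) (simp (+ d) (c * a) b) (ℤ.+-identityʳ (c * b)) ⟩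
    ∣ c * a ∣ ℕ.+ ∣ c * b ∣                            ≡⟨ cong₂ ℕ._+_ (abs-* c a) (abs-* c b) ⟩
    ∣ c ∣ ℕ.* ∣ a ∣ ℕ.+ ∣ c ∣ ℕ.* ∣ b ∣                ≡⟨ ℕ.*-distribˡ-+ (∣ c ∣) (∣ a ∣) (∣ b ∣) ⟨
    ∣ c ∣ ℕ.* (∣ a ∣ ℕ.+ ∣ b ∣)                        ∎
    where
    open ≡-Reasoning
    simp : ∀ d x b → x + d * (0ℤ * b) ≡ x
    simp d x b = trans (cong (λ y → x + y) (ℤ.*-zeroʳ d)) (ℤ.+-identityʳ x)

  height-⊗ : 0 ℕ.< d → ∀ z w → height (z ⊗ w) ℕ.≤ d ℕ.* (height z ℕ.* height w)
  height-⊗ 0<d (a +√d· b) (a′ +√d· b′) = begin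
    ∣ a * a′ + + d * (b * b′) ∣ ℕ.+ ∣ a * b′ + b * a′ ∣
      ≤⟨ ℕ.+-mono-≤ (∣i+j∣≤∣i∣+∣j∣ (a * a′) _) (∣i+j∣≤∣i∣+∣j∣ (a * b′) _) ⟩
    (∣ a * a′ ∣ ℕ.+ ∣ + d * (b * b′) ∣) ℕ.+ (∣ a * b′ ∣ ℕ.+ ∣ b * a′ ∣)
      ≡⟨ cong₂ (λ x y → x ℕ.+ y) (cong₂ ℕ._+_ (abs-* a a′) (trans (abs-* (+ d) (b * b′)) (cong (d ℕ.*_) (abs-* b b′))))
               (cong₂ ℕ._+_ (abs-* a b′) (abs-* b a′)) ⟩
    (A ℕ.* A′ ℕ.+ d ℕ.* (B ℕ.* B′)) ℕ.+ (A ℕ.* B′ ℕ.+ B ℕ.* A′)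
      -- Enlarging the terms that lack a factor d makes the sum factor.
      ≤⟨ ℕ.+-mono-≤ (ℕ.+-monoˡ-≤ _ (scale (A ℕ.* A′))) (scale (A ℕ.* B′ ℕ.+ B ℕ.* A′)) ⟩
    (d ℕ.* (A ℕ.* A′) ℕ.+ d ℕ.* (B ℕ.* B′)) ℕ.+ d ℕ.* (A ℕ.* B′ ℕ.+ B ℕ.* A′)
      ≡⟨ collect d A A′ B B′ ⟩
    d ℕ.* ((A ℕ.+ B) ℕ.* (A′ ℕ.+ B′)) ∎
    where
    open ℕ.≤-Reasoning
    A = ∣ a ∣
    A′ = ∣ a′ ∣
    B = ∣ b ∣
    B′ = ∣ b′ ∣
    scale : ∀ x → x ℕ.≤ d ℕ.* x
    scale x = ℕ.m≤n*m x d {{ℕ.>-nonZero 0<d}}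
    collect : ∀ d A A′ B B′ → (d ℕ.* (A ℕ.* A′) ℕ.+ d ℕ.* (B ℕ.* B′)) ℕ.+ d ℕ.* (A ℕ.* B′ ℕ.+ B ℕ.* A′) ≡
                               d ℕ.* ((A ℕ.+ B) ℕ.* (A′ ℕ.+ B′))
    collect = ℕ-solve-∀

  ∣re-z⊗z∣ : (z : ℤ[√ d ]) → ∣ re (z ⊗ z) ∣ ≡ ∣ re z ∣ ℕ.* ∣ re z ∣ ℕ.+ d ℕ.* (∣ im z ∣ ℕ.* ∣ im z ∣)
  ∣re-z⊗z∣ (a +√d· b) = cong ∣_∣ (begin
    a * a + + d * (b * b)                                ≡⟨ cong₂ (λ x y → x + + d * y) (i*i≡+∣i∣*∣i∣ a) (i*i≡+∣i∣*∣i∣ b) ⟩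
    + (∣ a ∣ ℕ.* ∣ a ∣) + + d * + (∣ b ∣ ℕ.* ∣ b ∣)      ≡⟨ cong (λ y → + (∣ a ∣ ℕ.* ∣ a ∣) + y) (ℤ.pos-* d _) ⟨
    + (∣ a ∣ ℕ.* ∣ a ∣ ℕ.+ d ℕ.* (∣ b ∣ ℕ.* ∣ b ∣))      ∎)
    where open ≡-Reasoning

  -- Nothing cancels in the real part a² + d b² of a square. Hence a bound on a square bounds its
  -- roots.
  height≤∣re-z⊗z∣ : 0 ℕ.< d → (z : ℤ[√ d ]) → height z ℕ.≤ ∣ re (z ⊗ z) ∣
  height≤∣re-z⊗z∣ 0<d z = begin
    ∣ a ∣ ℕ.+ ∣ b ∣                                   ≤⟨ ℕ.+-mono-≤ (m≤m*m (∣ a ∣)) (m≤m*m (∣ b ∣)) ⟩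
    ∣ a ∣ ℕ.* ∣ a ∣ ℕ.+ ∣ b ∣ ℕ.* ∣ b ∣               ≤⟨ ℕ.+-monoʳ-≤ (∣ a ∣ ℕ.* ∣ a ∣) (ℕ.m≤n*m _ d {{ℕ.>-nonZero 0<d}}) ⟩
    ∣ a ∣ ℕ.* ∣ a ∣ ℕ.+ d ℕ.* (∣ b ∣ ℕ.* ∣ b ∣)       ≡⟨ ∣re-z⊗z∣ z ⟨
    ∣ re (z ⊗ z) ∣                                    ∎
    where
    open ℕ.≤-Reasoning
    a = re z
    b = im z

  height≤height-z⊗z : 0 ℕ.< d → ∀ z → height z ℕ.≤ height (z ⊗ z)
  height≤height-z⊗z 0<d z = ℕ.≤-trans (height≤∣re-z⊗z∣ 0<d z) (ℕ.m≤m+n (∣ re (z ⊗ z) ∣) (∣ im (z ⊗ z) ∣))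

  module _ {n : ℤ[√ d ]} where
    open DQuadruple

    totalHeight : DQuadruple n → ℕ
    totalHeight q = height (elem q 0F) ℕ.+ (height (elem q 1F) ℕ.+ (height (elem q 2F) ℕ.+ height (elem q 3F)))

    height-elem : ∀ q i → height (elem q i) ℕ.≤ totalHeight q
    height-elem q = λ
      { 0F → ℕ.m≤m+n h₀ (h₁ ℕ.+ (h₂ ℕ.+ h₃))
      ; 1F → ℕ.m≤n⇒m≤o+n h₀ (ℕ.m≤m+n h₁ (h₂ ℕ.+ h₃))
      ; 2F → ℕ.m≤n⇒m≤o+n h₀ (ℕ.m≤n⇒m≤o+n h₁ (ℕ.m≤m+n h₂ h₃))
      ; 3F → ℕ.m≤n⇒m≤o+n h₀ (ℕ.m≤n⇒m≤o+n h₁ (ℕ.m≤n+m h₃ h₂))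
      }
      where
      h₀ = height (elem q 0F)
      h₁ = height (elem q 1F)
      h₂ = height (elem q 2F)
      h₃ = height (elem q 3F)

    -- Each quadruple is chosen with an element taller than all elements of its predecessors, so as
    -- a set it is contained in none of them.
    unbounded⇒infinite : (∀ B → ∃ λ (q : DQuadruple n) → ∃ λ i → B ℕ.< height (elem q i)) → Infinite (DQuadrupleSetoid n)
    unbounded⇒infinite large = record
      { to = quad
      ; cong = λ { {i} refl → Setoid.refl (DQuadrupleSetoid n) {quad i} }
      ; injective = injective
      }
      where
      bound : ℕ → ℕ
      quad : ℕ → DQuadruple n
      quad j = proj₁ (large (bound j))
      bound zero = 0
      -- Summing all the totals, instead of keeping the last one, makes `bound` monotone.
      bound (suc j) = totalHeight (quad j) ℕ.+ bound j

      bound-mono : ∀ {i j} → i ℕ.≤′ j → bound i ℕ.≤ bound j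
      bound-mono ℕ.≤′-refl = ℕ.≤-refl
      bound-mono (ℕ.≤′-step {j} i≤j) = ℕ.m≤n⇒m≤o+n (totalHeight (quad j)) (bound-mono i≤j)

      set-⊈ : ∀ {i j} → i ℕ.< j → ¬ (∀ {z} → set (quad j) z → set (quad i) z)
      set-⊈ {i} {j} i<j ⊆ = let
        k , tall = proj₂ (large (bound j))
        l , eq = ⊆ (k , refl)
        in ℕ.<-irrefl refl (begin-strict
          bound j                  <⟨ tall ⟩
          height (elem (quad j) k) ≡⟨ cong height {x = elem (quad i) l} {elem (quad j) k} eq ⟨
          height (elem (quad i) l) ≤⟨ height-elem (quad i) l ⟩
          totalHeight (quad i)     ≤⟨ ℕ.m≤m+n (totalHeight (quad i)) (bound i) ⟩
          bound (suc i)            ≤⟨ bound-mono (ℕ.≤⇒≤′ i<j) ⟩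
          bound j                  ∎)
        where open ℕ.≤-Reasoning

      injective : Injective _≡_ (Setoid._≈_ (DQuadrupleSetoid n)) quad
      injective {i} {j} (⊆ , ⊇) with ℕ.<-cmp i j
      ... | tri< i<j _ _ = contradiction (λ {z} → ⊇ {z}) (set-⊈ {i} {j} i<j)
      ... | tri≈ _ i≡j _ = i≡j
      ... | tri> _ _ j<i = contradiction (λ {z} → ⊆ {z}) (set-⊈ {j} {i} j<i)

-- Quadruples from a, b and r

onPairs : {P : Fin 4 → Fin 4 → Set} →
          P 0F 1F → P 0F 2F → P 0F 3F → P 1F 2F → P 1F 3F → P 2F 3F →
          ∀ i j → i Fin.< j → P i j
onPairs p q r s t u 0F 0F ()
onPairs p q r s t u 0F 1F _ = p
onPairs p q r s t u 0F 2F _ = q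
onPairs p q r s t u 0F 3F _ = r
onPairs p q r s t u 1F 0F ()
onPairs p q r s t u 1F 1F (s≤s ())
onPairs p q r s t u 1F 2F _ = s
onPairs p q r s t u 1F 3F _ = t
onPairs p q r s t u 2F 0F ()
onPairs p q r s t u 2F 1F (s≤s ())
onPairs p q r s t u 2F 2F (s≤s (s≤s ()))
onPairs p q r s t u 2F 3F _ = u
onPairs p q r s t u 3F 0F ()
onPairs p q r s t u 3F 1F (s≤s ())
onPairs p q r s t u 3F 2F (s≤s (s≤s ()))
onPairs p q r s t u 3F 3F (s≤s (s≤s (s≤s ())))

distinct⇒injective : ∀ {A : Set} {k} (f : Fin k → A) → (∀ i j → i Fin.< j → f i ≢ f j) → Injective _≡_ _≡_ f
distinct⇒injective f distinct {i} {j} fi≡fj with Fin.<-cmp i j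
... | tri< i<j _ _ = contradiction fi≡fj (distinct i j i<j)
... | tri≈ _ i≡j _ = i≡j
... | tri> _ _ j<i = contradiction (sym fi≡fj) (distinct j i j<i)

module _ {d : ℕ} where

  -- With T = a + 2 r, the element s = T + z is a root of X² − 2 T X + 3 n.
  record Solution (a n s : ℤ[√ d ]) : Set where
    constructor solution
    field
      b r z : ℤ[√ d ]
      a⊗b⊕n≡r⊗r : a ⊗ b ⊕ n ≡ r ⊗ r
      T⊗T≡z⊗z⊕3n : (a ⊕ # 2 ⊗ r) ⊗ (a ⊕ # 2 ⊗ r) ≡ z ⊗ z ⊕ # 3 ⊗ n
      s≡T⊕z : s ≡ a ⊕ # 2 ⊗ r ⊕ z

module _ {d : ℕ} (0<d : 0 ℕ.< d) where
  open ℤ[√]-Solver {d} using (solve; _:=_; _:+_; _:*_; :-_; con)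

  -- One bound for nine coincidences: 36 and 4 are the largest coefficients of n and a² in the
  -- equations they produce, and the last summand pays for moving ± a across.
  threshold : (a n : ℤ[√ d ]) → ℕ
  threshold a n = (36 ℕ.* height n ℕ.+ 4 ℕ.* height (a ⊗ a)) ℕ.+ height a

  -- The root is no taller than its square, and T is recovered from the root by removing σ a. The
  -- conditions on the literals are settled by evaluation.
  square⇒height≤ : ∀ c σ y w (T a n : ℤ[√ d ])
    {_ : True (1 ℕ.≤? ∣ c ∣)} {_ : True (∣ σ ∣ ℕ.≤? 1)} {_ : True (∣ y ∣ ℕ.≤? 36)} {_ : True (∣ w ∣ ℕ.≤? 4)} →
    (fromℤ c ⊗ T ⊕ fromℤ σ ⊗ a) ⊗ (fromℤ c ⊗ T ⊕ fromℤ σ ⊗ a) ≡ fromℤ y ⊗ n ⊕ fromℤ w ⊗ (a ⊗ a) →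
    height T ℕ.≤ threshold a n
  square⇒height≤ c σ y w T a n {1≤c} {σ≤1} {y≤36} {w≤4} U²≡V = begin
    height T
      ≤⟨ ℕ.m≤n*m (height T) (∣ c ∣) {{ℕ.>-nonZero (toWitness 1≤c)}} ⟩
    ∣ c ∣ ℕ.* height T
      ≡⟨ height-fromℤ-⊗ c T ⟨
    height (fromℤ c ⊗ T)
      ≡⟨ cong height (add-sub (fromℤ c ⊗ T) (fromℤ σ ⊗ a)) ⟩
    height (U ⊕ ⊝ (fromℤ σ ⊗ a))
      ≤⟨ height-⊕ U (⊝ (fromℤ σ ⊗ a)) ⟩
    height U ℕ.+ height (⊝ (fromℤ σ ⊗ a))
      ≤⟨ ℕ.+-mono-≤ U≤ σa≤ ⟩
    threshold a n ∎
    where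
    open ℕ.≤-Reasoning
    U = fromℤ c ⊗ T ⊕ fromℤ σ ⊗ a
    add-sub : ∀ x y → x ≡ x ⊕ y ⊕ ⊝ y
    add-sub = solve 2 (λ x y → x := x :+ y :+ :- y) refl
    U≤ : height U ℕ.≤ 36 ℕ.* height n ℕ.+ 4 ℕ.* height (a ⊗ a)
    U≤ = begin
      height U                                           ≤⟨ height≤height-z⊗z 0<d U ⟩
      height (U ⊗ U)                                     ≡⟨ cong height U²≡V ⟩
      height (fromℤ y ⊗ n ⊕ fromℤ w ⊗ (a ⊗ a))           ≤⟨ height-⊕ (fromℤ y ⊗ n) _ ⟩
      height (fromℤ y ⊗ n) ℕ.+ height (fromℤ w ⊗ (a ⊗ a)) ≡⟨ cong₂ ℕ._+_ (height-fromℤ-⊗ y n) (height-fromℤ-⊗ w (a ⊗ a)) ⟩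
      ∣ y ∣ ℕ.* height n ℕ.+ ∣ w ∣ ℕ.* height (a ⊗ a)    ≤⟨ ℕ.+-mono-≤ (ℕ.*-monoˡ-≤ (height n) (toWitness y≤36)) (ℕ.*-monoˡ-≤ (height (a ⊗ a)) (toWitness w≤4)) ⟩
      36 ℕ.* height n ℕ.+ 4 ℕ.* height (a ⊗ a)           ∎
    σa≤ : height (⊝ (fromℤ σ ⊗ a)) ℕ.≤ height a
    σa≤ = begin
      height (⊝ (fromℤ σ ⊗ a)) ≡⟨ height-⊝ (fromℤ σ ⊗ a) ⟩
      height (fromℤ σ ⊗ a)     ≡⟨ height-fromℤ-⊗ σ a ⟩
      ∣ σ ∣ ℕ.* height a       ≤⟨ ℕ.*-monoˡ-≤ (height a) (toWitness σ≤1) ⟩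
      1 ℕ.* height a           ≡⟨ ℕ.*-identityˡ (height a) ⟩
      height a                 ∎

  -- The element c = a + b + 2 r extends the pair a, b with root r, and e = b + c + 2 (b + r)
  -- extends b, c with root b + r by the same rule. With n eliminated as r² - a b, only the pair a,
  -- e needs more than a polynomial identity.
  module Extension (a b r : ℤ[√ d ]) where
    n T c e : ℤ[√ d ]
    n = r ⊗ r ⊕ ⊝ (a ⊗ b)
    T = a ⊕ # 2 ⊗ r
    c = a ⊕ b ⊕ # 2 ⊗ r
    e = a ⊕ # 4 ⊗ b ⊕ # 4 ⊗ r

    elements : Fin 4 → ℤ[√ d ]
    elements 0F = a
    elements 1F = b
    elements 2F = c
    elements 3F = e

    squares : ∀ z → T ⊗ T ≡ z ⊗ z ⊕ # 3 ⊗ n → ∀ i j → i Fin.< j → IsSquare (elements i ⊗ elements j ⊕ n)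
    squares z T²≡z²+3n = onPairs
      (r , solve 3 (λ a b r → r :* r := a :* b :+ (r :* r :+ :- (a :* b))) refl a b r)
      (a ⊕ r , solve 3 (λ a b r → (a :+ r) :* (a :+ r) := a :* (a :+ b :+ con (+ 2) :* r) :+ (r :* r :+ :- (a :* b))) refl a b r)
      -- The one genuine condition: a e + n = T² - 3 n.
      (z , trans (solve 2 (λ z n → z :* z := z :* z :+ con (+ 3) :* n :+ :- (con (+ 3) :* n)) refl z n)
          (trans (cong (λ x → x ⊕ ⊝ (# 3 ⊗ n)) (sym T²≡z²+3n))
            (solve 3 (λ a b r → let n = r :* r :+ :- (a :* b); T = a :+ con (+ 2) :* r in
               T :* T :+ :- (con (+ 3) :* n) := a :* (a :+ con (+ 4) :* b :+ con (+ 4) :* r) :+ n) refl a b r)))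
      (b ⊕ r , solve 3 (λ a b r → (b :+ r) :* (b :+ r) := b :* (a :+ b :+ con (+ 2) :* r) :+ (r :* r :+ :- (a :* b))) refl a b r)
      (# 2 ⊗ b ⊕ r , solve 3 (λ a b r → (con (+ 2) :* b :+ r) :* (con (+ 2) :* b :+ r) :=
         b :* (a :+ con (+ 4) :* b :+ con (+ 4) :* r) :+ (r :* r :+ :- (a :* b))) refl a b r)
      (a ⊕ # 2 ⊗ b ⊕ # 3 ⊗ r , solve 3 (λ a b r → let w = a :+ con (+ 2) :* b :+ con (+ 3) :* r in
         w :* w := (a :+ b :+ con (+ 2) :* r) :* (a :+ con (+ 4) :* b :+ con (+ 4) :* r) :+ (r :* r :+ :- (a :* b))) refl a b r)

    module _ (large : threshold a n ℕ.< height T) where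

      -- A zero element or two equal elements force an equation
      -- (k T + σ a)² = y n + w a², which bounds the height of T.
      separate : ∀ k σ y w
        {1≤k : True (1 ℕ.≤? ∣ k ∣)} {σ≤1 : True (∣ σ ∣ ℕ.≤? 1)} {y≤36 : True (∣ y ∣ ℕ.≤? 36)} {w≤4 : True (∣ w ∣ ℕ.≤? 4)} →
        ∀ g {x x′} → (fromℤ k ⊗ T ⊕ fromℤ σ ⊗ a) ⊗ (fromℤ k ⊗ T ⊕ fromℤ σ ⊗ a) ≡
        fromℤ y ⊗ n ⊕ fromℤ w ⊗ (a ⊗ a) ⊕ g ⊗ (x ⊕ ⊝ x′) →
        x ≢ x′
      separate k σ y w {p} {q} {s} {t} g {x} eq refl = ℕ.<-irrefl refl (ℕ.<-≤-trans large
        (square⇒height≤ k σ y w T a n {p} {q} {s} {t} (trans eq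
          (solve 3 (λ v g x → v :+ g :* (x :+ :- x) := v) refl (fromℤ y ⊗ n ⊕ fromℤ w ⊗ (a ⊗ a)) g x))))

      -- An equality other than b = c can be solved for b, up to a factor 3. Substituted into n = r²
      -- - a b it leaves a quadratic in r, whose completed square, with denominators cleared, is the
      -- left side of the equation. The equality b = c means T = 0.
      distinct : ∀ i j → i Fin.< j → elements i ≢ elements j
      distinct = onPairs
        (separate (+ 1) (- 1ℤ) (+ 4) (+ 4) (⊝ (# 4 ⊗ a)) {a} {b}
          (solve 3 (λ a b r → let n = r :* r :+ :- (a :* b); U = con (+ 1) :* (a :+ con (+ 2) :* r) :+ con (- 1ℤ) :* a in
             U :* U := con (+ 4) :* n :+ con (+ 4) :* (a :* a) :+ :- (con (+ 4) :* a) :* (a :+ :- b)) refl a b r))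
        (separate (+ 1) (+ 1) (+ 4) (+ 4) (⊝ (# 4 ⊗ a)) {a} {c}
          (solve 3 (λ a b r → let n = r :* r :+ :- (a :* b); U = con (+ 1) :* (a :+ con (+ 2) :* r) :+ con (+ 1) :* a in
             U :* U := con (+ 4) :* n :+ con (+ 4) :* (a :* a) :+ :- (con (+ 4) :* a) :* (a :+ :- (a :+ b :+ con (+ 2) :* r))) refl a b r))
        (separate (+ 1) (+ 0) (+ 4) (+ 1) (⊝ a) {a} {e}
          (solve 3 (λ a b r → let n = r :* r :+ :- (a :* b); U = con (+ 1) :* (a :+ con (+ 2) :* r) :+ con (+ 0) :* a in
             U :* U := con (+ 4) :* n :+ con (+ 1) :* (a :* a) :+ :- a :* (a :+ :- (a :+ con (+ 4) :* b :+ con (+ 4) :* r))) refl a b r))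
        (separate (+ 1) (+ 0) (+ 0) (+ 0) (⊝ T) {b} {c}
          (solve 3 (λ a b r → let n = r :* r :+ :- (a :* b); T = a :+ con (+ 2) :* r; U = con (+ 1) :* T :+ con (+ 0) :* a in
             U :* U := con (+ 0) :* n :+ con (+ 0) :* (a :* a) :+ :- T :* (b :+ :- (a :+ b :+ con (+ 2) :* r))) refl a b r))
        (separate (+ 3) (+ 1) (+ 36) (+ 4) (⊝ (# 12 ⊗ a)) {b} {e}
          (solve 3 (λ a b r → let n = r :* r :+ :- (a :* b); U = con (+ 3) :* (a :+ con (+ 2) :* r) :+ con (+ 1) :* a in
             U :* U := con (+ 36) :* n :+ con (+ 4) :* (a :* a) :+ :- (con (+ 12) :* a) :* (b :+ :- (a :+ con (+ 4) :* b :+ con (+ 4) :* r))) refl a b r))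
        (separate (+ 3) (- 1ℤ) (+ 36) (+ 4) (⊝ (# 12 ⊗ a)) {c} {e}
          (solve 3 (λ a b r → let n = r :* r :+ :- (a :* b); U = con (+ 3) :* (a :+ con (+ 2) :* r) :+ con (- 1ℤ) :* a in
             U :* U := con (+ 36) :* n :+ con (+ 4) :* (a :* a) :+ :- (con (+ 12) :* a) :* ((a :+ b :+ con (+ 2) :* r) :+ :- (a :+ con (+ 4) :* b :+ con (+ 4) :* r))) refl a b r))

      nonZero : a ≢ 𝟘 → ∀ i → elements i ≢ 𝟘
      nonZero a≢𝟘 0F = a≢𝟘
      nonZero _ 1F = separate (+ 1) (- 1ℤ) (+ 4) (+ 0) (# 4 ⊗ a) {b} {𝟘}
        (solve 3 (λ a b r → let n = r :* r :+ :- (a :* b); U = con (+ 1) :* (a :+ con (+ 2) :* r) :+ con (- 1ℤ) :* a in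
           U :* U := con (+ 4) :* n :+ con (+ 0) :* (a :* a) :+ con (+ 4) :* a :* (b :+ :- con (+ 0))) refl a b r)
      nonZero _ 2F = separate (+ 1) (+ 1) (+ 4) (+ 0) (# 4 ⊗ a) {c} {𝟘}
        (solve 3 (λ a b r → let n = r :* r :+ :- (a :* b); U = con (+ 1) :* (a :+ con (+ 2) :* r) :+ con (+ 1) :* a in
           U :* U := con (+ 4) :* n :+ con (+ 0) :* (a :* a) :+ con (+ 4) :* a :* ((a :+ b :+ con (+ 2) :* r) :+ :- con (+ 0))) refl a b r)
      nonZero _ 3F = separate (+ 1) (+ 0) (+ 4) (+ 0) a {e} {𝟘}
        (solve 3 (λ a b r → let n = r :* r :+ :- (a :* b); U = con (+ 1) :* (a :+ con (+ 2) :* r) :+ con (+ 0) :* a in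
           U :* U := con (+ 4) :* n :+ con (+ 0) :* (a :* a) :+ a :* ((a :+ con (+ 4) :* b :+ con (+ 4) :* r) :+ :- con (+ 0))) refl a b r)

      quadruple : a ≢ 𝟘 → ∀ z → T ⊗ T ≡ z ⊗ z ⊕ # 3 ⊗ n → DQuadruple n
      quadruple a≢𝟘 z T²≡z²+3n = record
        { elem     = elements
        ; distinct = distinct⇒injective elements distinct
        ; nonZero  = nonZero a≢𝟘
        ; square   = squares z T²≡z²+3n
        }

    height-T≤ : height T ℕ.≤ height c ℕ.+ height b
    height-T≤ = begin
      height T                     ≡⟨ cong height (solve 3 (λ a b r → a :+ con (+ 2) :* r := a :+ b :+ con (+ 2) :* r :+ :- b) refl a b r) ⟩
      height (c ⊕ ⊝ b)             ≤⟨ height-⊕ c (⊝ b) ⟩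
      height c ℕ.+ height (⊝ b)    ≡⟨ cong (height c ℕ.+_) (height-⊝ b) ⟩
      height c ℕ.+ height b        ∎
      where open ℕ.≤-Reasoning

  -- As T = c - b, a height of T above 2 B makes b or c taller than B; the summand `threshold a n`
  -- secures distinct non-zero elements.
  tallQuadruple : ∀ {a n r z} b → a ≢ 𝟘 → n ≡ r ⊗ r ⊕ ⊝ (a ⊗ b) →
                  (a ⊕ # 2 ⊗ r) ⊗ (a ⊕ # 2 ⊗ r) ≡ z ⊗ z ⊕ # 3 ⊗ n →
                  ∀ B → threshold a n ℕ.+ (B ℕ.+ B) ℕ.< height (a ⊕ # 2 ⊗ r) →
                  ∃ λ (q : DQuadruple n) → ∃ λ i → B ℕ.< height (DQuadruple.elem q i)
  tallQuadruple {a} {_} {r} {z} b a≢𝟘 refl eq B B<T = quad , tall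
    where
    open Extension a b r
    quad = quadruple (ℕ.≤-<-trans (ℕ.m≤m+n (threshold a n) (B ℕ.+ B)) B<T) a≢𝟘 z eq
    tall : ∃ λ i → B ℕ.< height (elements i)
    tall with B ℕ.<? height b | B ℕ.<? height c
    ... | yes B<b | _ = 1F , B<b
    ... | no _ | yes B<c = 2F , B<c
    ... | no B≮b | no B≮c = contradiction
      (ℕ.≤-<-trans (ℕ.m≤n+m (B ℕ.+ B) (threshold a n)) B<T)
      (ℕ.≤⇒≯ (ℕ.≤-trans height-T≤ (ℕ.+-mono-≤ (ℕ.≮⇒≥ B≮c) (ℕ.≮⇒≥ B≮b))))

  -- A tall s needs a tall T: z² = T² - 3 n bounds z by a quadratic expression in the height of T,
  -- and s = T + z.
  solutions⇒infinite : ∀ {a n} → a ≢ 𝟘 → (∀ B → ∃ λ s → B ℕ.< height s × Solution a n s) →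
                       Infinite (DQuadrupleSetoid n)
  solutions⇒infinite {a} {n} a≢𝟘 solutions = unbounded⇒infinite tall
    where
    tall : ∀ B → ∃ λ (q : DQuadruple n) → ∃ λ i → B ℕ.< height (DQuadruple.elem q i)
    tall B with B₁ ← threshold a n ℕ.+ (B ℕ.+ B) in eq
           with s , B<s , solution b r z e₁ e₂ e₃
                ← solutions (B₁ ℕ.+ (d ℕ.* (B₁ ℕ.* B₁) ℕ.+ 3 ℕ.* height n)) =
      tallQuadruple {r = r} {z} b a≢𝟘 n≡ e₂ B (subst (ℕ._< height T) (sym eq) (ℕ.≰⇒> T≰))
      where
      open ℕ.≤-Reasoning
      T = a ⊕ # 2 ⊗ r
      n≡ : n ≡ r ⊗ r ⊕ ⊝ (a ⊗ b)
      n≡ = trans (solve 2 (λ n x → n := x :+ n :+ :- x) refl n (a ⊗ b)) (cong (λ x → x ⊕ ⊝ (a ⊗ b)) e₁)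
      z≤ : height z ℕ.≤ d ℕ.* (height T ℕ.* height T) ℕ.+ 3 ℕ.* height n
      z≤ = begin
        height z                                                 ≤⟨ height≤height-z⊗z 0<d z ⟩
        height (z ⊗ z)                                           ≡⟨ cong height (solve 2 (λ x y → x := x :+ y :+ :- y) refl (z ⊗ z) (# 3 ⊗ n)) ⟩
        height (z ⊗ z ⊕ # 3 ⊗ n ⊕ ⊝ (# 3 ⊗ n))                   ≡⟨ cong (λ x → height (x ⊕ ⊝ (# 3 ⊗ n))) e₂ ⟨
        height (T ⊗ T ⊕ ⊝ (# 3 ⊗ n))                             ≤⟨ height-⊕ (T ⊗ T) _ ⟩
        height (T ⊗ T) ℕ.+ height (⊝ (# 3 ⊗ n))                  ≤⟨ ℕ.+-mono-≤ (height-⊗ 0<d T T) (ℕ.≤-reflexive (trans (height-⊝ (# 3 ⊗ n)) (height-fromℤ-⊗ (+ 3) n))) ⟩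
        d ℕ.* (height T ℕ.* height T) ℕ.+ 3 ℕ.* height n         ∎
      T≰ : ¬ (height T ℕ.≤ B₁)
      T≰ T≤ = ℕ.<-irrefl refl (begin-strict
        B₁ ℕ.+ (d ℕ.* (B₁ ℕ.* B₁) ℕ.+ 3 ℕ.* height n)    <⟨ B<s ⟩
        height s                                         ≡⟨ cong height e₃ ⟩
        height (T ⊕ z)                                   ≤⟨ height-⊕ T z ⟩
        height T ℕ.+ height z                            ≤⟨ ℕ.+-mono-≤ T≤ (ℕ.≤-trans z≤ (ℕ.+-monoˡ-≤ _ (ℕ.*-monoʳ-≤ d (ℕ.*-mono-≤ T≤ T≤)))) ⟩
        B₁ ℕ.+ (d ℕ.* (B₁ ℕ.* B₁) ℕ.+ 3 ℕ.* height n)    ∎)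

-- Norms, conjugation and tall units

module _ {d : ℕ} where

  norm-⊗ : (z w : ℤ[√ d ]) → norm (z ⊗ w) ≡ norm z * norm w
  norm-⊗ (a +√d· b) (a′ +√d· b′) = brahmagupta (+ d) a b a′ b′
    where
    brahmagupta : ∀ d a b a′ b′ → (a * a′ + d * (b * b′)) * (a * a′ + d * (b * b′)) - d * ((a * b′ + b * a′) * (a * b′ + b * a′)) ≡
                                   (a * a - d * (b * b)) * (a′ * a′ - d * (b′ * b′))
    brahmagupta = solve-∀

  conj-⊗-self : (z : ℤ[√ d ]) → conj z ⊗ z ≡ fromℤ (norm z)
  conj-⊗-self (a +√d· b) = ext (re-eq (+ d) a b) (im-eq a b)
    where
    re-eq : ∀ d a b → a * a + d * (- b * b) ≡ a * a - d * (b * b)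
    re-eq = solve-∀
    im-eq : ∀ a b → a * b + - b * a ≡ 0ℤ
    im-eq = solve-∀

  norm-conj : (z : ℤ[√ d ]) → norm (conj z) ≡ norm z
  norm-conj (a +√d· b) = eq (+ d) a b
    where
    eq : ∀ d a b → a * a - d * (- b * - b) ≡ a * a - d * (b * b)
    eq = solve-∀

module _ {d : ℕ} (0<d : 0 ℕ.< d) where

  module _ (z : ℤ[√ d ]) (0<re : 0 ℕ.< ∣ re z ∣) (0<im : 0 ℕ.< ∣ im z ∣) where

    0<∣re-z⊗z∣ : 0 ℕ.< ∣ re (z ⊗ z) ∣
    0<∣re-z⊗z∣ = ℕ.≤-trans 0<re (ℕ.≤-trans (ℕ.m≤m+n (∣ re z ∣) (∣ im z ∣)) (height≤∣re-z⊗z∣ 0<d z))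

    0<∣im-z⊗z∣ : 0 ℕ.< ∣ im (z ⊗ z) ∣
    0<∣im-z⊗z∣ = subst (0 ℕ.<_) (sym (begin
      ∣ re z * im z + im z * re z ∣           ≡⟨ cong ∣_∣ (double (re z) (im z)) ⟩
      ∣ + 2 * (re z * im z) ∣                 ≡⟨ abs-* (+ 2) (re z * im z) ⟩
      2 ℕ.* ∣ re z * im z ∣                   ≡⟨ cong (2 ℕ.*_) (abs-* (re z) (im z)) ⟩
      2 ℕ.* (∣ re z ∣ ℕ.* ∣ im z ∣)           ∎))
      (ℕ.*-mono-≤ {1} {2} (s≤s z≤n) (ℕ.*-mono-≤ 0<re 0<im))
      where
      open ≡-Reasoning
      double : ∀ a b → a * b + b * a ≡ + 2 * (a * b)
      double = solve-∀

    height<height-z⊗z : height z ℕ.< height (z ⊗ z)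
    height<height-z⊗z = ℕ.≤-<-trans (height≤∣re-z⊗z∣ 0<d z) (ℕ.m<m+n (∣ re (z ⊗ z) ∣) 0<∣im-z⊗z∣)

  module _ (ε : ℤ[√ d ]) (norm-ε : norm ε ≡ - 1ℤ) (0<re-ε : 0 ℕ.< ∣ re ε ∣) (0<im-ε : 0 ℕ.< ∣ im ε ∣) where

    private
      -- Repeated squaring starts from ε², of norm 1. Both coordinates stay non-zero, which makes
      -- every square strictly taller than its root.
      tall : ∀ B → ∃ λ (u : ℤ[√ d ]) → norm u ≡ 1ℤ × 0 ℕ.< ∣ re u ∣ × 0 ℕ.< ∣ im u ∣ × B ℕ.< height u
      tall zero = ε ⊗ ε , trans (norm-⊗ ε ε) (cong₂ _*_ norm-ε norm-ε) , 0<∣re-z⊗z∣ ε 0<re-ε 0<im-ε , 0<∣im-z⊗z∣ ε 0<re-ε 0<im-ε ,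
        ℕ.≤-<-trans z≤n (height<height-z⊗z ε 0<re-ε 0<im-ε)
      tall (suc B) with u , norm-u , 0<re , 0<im , B<u ← tall B =
        u ⊗ u , trans (norm-⊗ u u) (cong₂ _*_ norm-u norm-u) , 0<∣re-z⊗z∣ u 0<re 0<im , 0<∣im-z⊗z∣ u 0<re 0<im ,
        ℕ.≤-<-trans B<u (height<height-z⊗z u 0<re 0<im)

    -- Multiplying ζ u by the conjugate of ζ returns a non-zero integer multiple of u, so ζ u cannot
    -- stay short while u grows.
    tallUnitMultiple : ∀ ζ → 0 ℕ.< ∣ norm ζ ∣ → ∀ B → ∃ λ (u : ℤ[√ d ]) → norm u ≡ 1ℤ × B ℕ.< height (ζ ⊗ u)
    tallUnitMultiple ζ 0<N B with u , norm-u , _ , _ , B<u ← tall (d ℕ.* (height (conj ζ) ℕ.* B)) =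
      u , norm-u , ℕ.≰⇒> λ ζu≤B → ℕ.<-irrefl refl (begin-strict
        d ℕ.* (height (conj ζ) ℕ.* B)               <⟨ B<u ⟩
        height u                                    ≤⟨ ℕ.m≤n*m (height u) (∣ norm ζ ∣) {{ℕ.>-nonZero 0<N}} ⟩
        ∣ norm ζ ∣ ℕ.* height u                     ≡⟨ height-fromℤ-⊗ (norm ζ) u ⟨
        height (fromℤ (norm ζ) ⊗ u)                 ≡⟨ cong (λ x → height (x ⊗ u)) (conj-⊗-self ζ) ⟨
        height (conj ζ ⊗ ζ ⊗ u)                     ≡⟨ cong height (solve 3 (λ x y z → x :* y :* z := x :* (y :* z)) refl (conj ζ) ζ u) ⟩
        height (conj ζ ⊗ (ζ ⊗ u))                   ≤⟨ height-⊗ 0<d (conj ζ) (ζ ⊗ u) ⟩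
        d ℕ.* (height (conj ζ) ℕ.* height (ζ ⊗ u))  ≤⟨ ℕ.*-monoʳ-≤ d (ℕ.*-monoʳ-≤ (height (conj ζ)) ζu≤B) ⟩
        d ℕ.* (height (conj ζ) ℕ.* B)               ∎)
      where
      open ℕ.≤-Reasoning
      open ℤ[√]-Solver {d} using (solve; _:=_; _:*_)

-- Congruences modulo 8 and 3

Even Odd : ℤ → Set
Even x = ∃ λ u → x ≡ + 2 * u
Odd x = ∃ λ u → x ≡ + 2 * u + 1ℤ

parity : ∀ x → Even x ⊎ Odd x
parity x with x %ℕ 2 | n%ℕd<d x 2 | a≡a%ℕn+[a/ℕn]*n x 2
... | 0 | _ | eq = inj₁ (x /ℕ 2 , trans eq (lemma (x /ℕ 2)))
  where
  lemma : ∀ u → + 0 + u * + 2 ≡ + 2 * u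
  lemma = solve-∀
... | 1 | _ | eq = inj₂ (x /ℕ 2 , trans eq (lemma (x /ℕ 2)))
  where
  lemma : ∀ u → + 1 + u * + 2 ≡ + 2 * u + 1ℤ
  lemma = solve-∀
... | suc (suc _) | s≤s (s≤s ()) | _

residue₃ : ∀ x → ∃ λ u → x ≡ + 3 * u ⊎ x ≡ + 3 * u + 1ℤ ⊎ x ≡ + 3 * u + + 2
residue₃ x with x %ℕ 3 | n%ℕd<d x 3 | a≡a%ℕn+[a/ℕn]*n x 3
... | 0 | _ | eq = x /ℕ 3 , inj₁ (trans eq (lemma (x /ℕ 3)))
  where
  lemma : ∀ u → + 0 + u * + 3 ≡ + 3 * u
  lemma = solve-∀
... | 1 | _ | eq = x /ℕ 3 , inj₂ (inj₁ (trans eq (lemma (x /ℕ 3))))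
  where
  lemma : ∀ u → + 1 + u * + 3 ≡ + 3 * u + 1ℤ
  lemma = solve-∀
... | 2 | _ | eq = x /ℕ 3 , inj₂ (inj₂ (trans eq (lemma (x /ℕ 3))))
  where
  lemma : ∀ u → + 2 + u * + 3 ≡ + 3 * u + + 2
  lemma = solve-∀
... | suc (suc (suc _)) | s≤s (s≤s (s≤s ())) | _

square₃ : ∀ x → (∃ λ u → x ≡ + 3 * u) ⊎ (∃ λ w → x * x ≡ + 3 * w + 1ℤ)
square₃ x with residue₃ x
... | u , inj₁ x≡ = inj₁ (u , x≡)
... | u , inj₂ (inj₁ refl) = inj₂ (+ 3 * (u * u) + + 2 * u , lemma u)
  where
  lemma : ∀ u → (+ 3 * u + 1ℤ) * (+ 3 * u + 1ℤ) ≡ + 3 * (+ 3 * (u * u) + + 2 * u) + 1ℤ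
  lemma = solve-∀
... | u , inj₂ (inj₂ refl) = inj₂ (+ 3 * (u * u) + + 4 * u + 1ℤ , lemma u)
  where
  lemma : ∀ u → (+ 3 * u + + 2) * (+ 3 * u + + 2) ≡ + 3 * (+ 3 * (u * u) + + 4 * u + 1ℤ) + 1ℤ
  lemma = solve-∀

u*u+u-even : ∀ u → Even (u * u + u)
u*u+u-even u with parity u
... | inj₁ (t , refl) = t * (+ 2 * t + 1ℤ) , lemma t
  where
  lemma : ∀ t → (+ 2 * t) * (+ 2 * t) + + 2 * t ≡ + 2 * (t * (+ 2 * t + 1ℤ))
  lemma = solve-∀
... | inj₂ (t , refl) = (+ 2 * t + 1ℤ) * (t + 1ℤ) , lemma t
  where
  lemma : ∀ t → (+ 2 * t + 1ℤ) * (+ 2 * t + 1ℤ) + (+ 2 * t + 1ℤ) ≡ + 2 * ((+ 2 * t + 1ℤ) * (t + 1ℤ))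
  lemma = solve-∀

odd-square : ∀ v → ∃ λ w → (+ 2 * v + 1ℤ) * (+ 2 * v + 1ℤ) ≡ + 8 * w + 1ℤ
odd-square v with w , eq ← u*u+u-even v = w , trans (expand v) (trans (cong (λ t → + 4 * t + 1ℤ) eq) (collect w))
  where
  expand : ∀ v → (+ 2 * v + 1ℤ) * (+ 2 * v + 1ℤ) ≡ + 4 * (v * v + v) + 1ℤ
  expand = solve-∀
  collect : ∀ w → + 4 * (+ 2 * w) + 1ℤ ≡ + 8 * w + 1ℤ
  collect = solve-∀

odd⇒0<∣x∣ : ∀ {x} → Odd x → 0 ℕ.< ∣ x ∣
odd⇒0<∣x∣ {+ suc _} _ = s≤s z≤n
odd⇒0<∣x∣ { -[1+ _ ]} _ = s≤s z≤n
odd⇒0<∣x∣ {+ 0} (u , eq) = contradiction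
  (divides (- u) (trans (isolate u) (trans (cong (λ t → t - + 2 * u) (sym eq)) (negate u)))) (from-no (+ 2 ∣? 1ℤ))
  where
  isolate : ∀ u → 1ℤ ≡ + 2 * u + 1ℤ - + 2 * u
  isolate = solve-∀
  negate : ∀ u → 0ℤ - + 2 * u ≡ - u * + 2
  negate = solve-∀

-- x is odd because the coefficient 4 D + 2 is even, and y is odd because -1 is not a square modulo
-- 4. Odd squares are 1 modulo 8, so 4 D + 2 ≡ 2 modulo 8.
negativePell⇒ : ∀ D x y → x * x - (+ 4 * D + + 2) * (y * y) ≡ - 1ℤ → Even D × Odd x × Odd y
negativePell⇒ D x y eq with parity x | parity y
... | inj₁ (u , refl) | _ = contradiction (divides ((+ 2 * D + 1ℤ) * (y * y) - + 2 * (u * u)) (trans (cong -_ (sym eq)) (lemma D u y))) (from-no (+ 2 ∣? 1ℤ))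
  where
  lemma : ∀ D u y → - ((+ 2 * u) * (+ 2 * u) - (+ 4 * D + + 2) * (y * y)) ≡ ((+ 2 * D + 1ℤ) * (y * y) - + 2 * (u * u)) * + 2
  lemma = solve-∀
... | inj₂ (u , refl) | inj₁ (v , refl) = contradiction
  (divides ((+ 4 * D + + 2) * (v * v) - (u * u + u)) (trans (cong (λ t → 1ℤ - t) (sym eq)) (lemma D u v))) (from-no (+ 4 ∣? + 2))
  where
  lemma : ∀ D u v → 1ℤ - ((+ 2 * u + 1ℤ) * (+ 2 * u + 1ℤ) - (+ 4 * D + + 2) * ((+ 2 * v) * (+ 2 * v))) ≡
                    ((+ 4 * D + + 2) * (v * v) - (u * u + u)) * + 4
  lemma = solve-∀
... | inj₂ (u , refl) | inj₂ (v , refl) with parity D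
...   | inj₁ D-even = D-even , (u , refl) , (v , refl)
...   | inj₂ (g , refl) = contradiction (divides q (trans (cong (λ t → + 3 - t) (sym eq)) lemma)) (from-no (+ 8 ∣? + 4))
  where
  w = proj₁ (odd-square u)
  w′ = proj₁ (odd-square v)
  A = + 4 * (+ 2 * g + 1ℤ) + + 2
  q = A * w′ + g + 1ℤ - w
  final : ∀ g w w′ → + 3 - ((+ 8 * w + 1ℤ) - (+ 4 * (+ 2 * g + 1ℤ) + + 2) * (+ 8 * w′ + 1ℤ)) ≡
                     ((+ 4 * (+ 2 * g + 1ℤ) + + 2) * w′ + g + 1ℤ - w) * + 8
  final = solve-∀
  lemma : + 3 - ((+ 2 * u + 1ℤ) * (+ 2 * u + 1ℤ) - A * ((+ 2 * v + 1ℤ) * (+ 2 * v + 1ℤ))) ≡ q * + 8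
  lemma = trans (cong₂ (λ s t → + 3 - (s - A * t)) (proj₂ (odd-square u)) (proj₂ (odd-square v))) (final g w w′)

module _ (δ p q : ℤ) where
  evenNorm⇒ : ∀ c → p * p - (+ 8 * δ + + 2) * (q * q) ≡ + 2 * c → ¬ (+ 4 ∣ + 2 * c) → Even p × Odd q
  evenNorm⇒ c eq 4∤2c with parity p | parity q
  ... | inj₂ (u , refl) | _ = contradiction
    (divides (c - (+ 2 * (u * u) + + 2 * u) + (+ 4 * δ + 1ℤ) * (q * q))
      (trans (isolate δ q u) (trans (cong (λ t → t - + 4 * (u * u) - + 4 * u + (+ 8 * δ + + 2) * (q * q)) eq) (lemma δ q c u))))
    (from-no (+ 2 ∣? 1ℤ))
    where
    isolate : ∀ δ q u → 1ℤ ≡ (+ 2 * u + 1ℤ) * (+ 2 * u + 1ℤ) - (+ 8 * δ + + 2) * (q * q) - + 4 * (u * u) - + 4 * u + (+ 8 * δ + + 2) * (q * q)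
    isolate = solve-∀
    lemma : ∀ δ q c u → + 2 * c - + 4 * (u * u) - + 4 * u + (+ 8 * δ + + 2) * (q * q) ≡
                        (c - (+ 2 * (u * u) + + 2 * u) + (+ 4 * δ + 1ℤ) * (q * q)) * + 2
    lemma = solve-∀
  ... | inj₁ (u , refl) | inj₁ (v , refl) = contradiction
    (divides (u * u - (+ 8 * δ + + 2) * (v * v)) (trans (sym eq) (lemma δ u v))) 4∤2c
    where
    lemma : ∀ δ u v → (+ 2 * u) * (+ 2 * u) - (+ 8 * δ + + 2) * ((+ 2 * v) * (+ 2 * v)) ≡ (u * u - (+ 8 * δ + + 2) * (v * v)) * + 4
    lemma = solve-∀
  ... | inj₁ p-even | inj₂ q-odd = p-even , q-odd

module _ (δ P v : ℤ) where
  private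
    w = proj₁ (odd-square v)
    N = (+ 2 * P) * (+ 2 * P) - (+ 8 * δ + + 2) * ((+ 2 * v + 1ℤ) * (+ 2 * v + 1ℤ))
    expand : N ≡ + 4 * (P * P) - (+ 8 * δ + + 2) * (+ 8 * w + 1ℤ)
    expand = trans (cong (λ t → (+ 2 * P) * (+ 2 * P) - (+ 8 * δ + + 2) * t) (proj₂ (odd-square v))) (lemma P δ w)
      where
      lemma : ∀ P δ w → (+ 2 * P) * (+ 2 * P) - (+ 8 * δ + + 2) * (+ 8 * w + 1ℤ) ≡ + 4 * (P * P) - (+ 8 * δ + + 2) * (+ 8 * w + 1ℤ)
      lemma = solve-∀

  -- Modulo 8 the norm N is 4 P² - 2, so its sign decides the parity of P.
  norm≡6⇒Even : N ≡ + 6 → Even P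
  norm≡6⇒Even eq with parity P
  ... | inj₁ P-even = P-even
  ... | inj₂ (t , refl) = contradiction
    (divides (+ 2 * (t * t) + + 2 * t - δ * (+ 8 * w + 1ℤ) - + 2 * w) (trans (cong (λ x → x - + 2) (trans (sym eq) expand)) (lemma t δ w))) (from-no (+ 8 ∣? + 4))
    where
    lemma : ∀ t δ w → + 4 * ((+ 2 * t + 1ℤ) * (+ 2 * t + 1ℤ)) - (+ 8 * δ + + 2) * (+ 8 * w + 1ℤ) - + 2 ≡
                      (+ 2 * (t * t) + + 2 * t - δ * (+ 8 * w + 1ℤ) - + 2 * w) * + 8
    lemma = solve-∀

  norm≡-6⇒Odd : N ≡ - + 6 → Odd P
  norm≡-6⇒Odd eq with parity P
  ... | inj₂ P-odd = P-odd
  ... | inj₁ (t , refl) = contradiction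
    (divides (+ 2 * (t * t) - δ * (+ 8 * w + 1ℤ) - + 2 * w) (trans (cong (λ x → x + + 2) (trans (sym eq) expand)) (lemma t δ w))) (from-no (+ 8 ∣? - + 4))
    where
    lemma : ∀ t δ w → + 4 * ((+ 2 * t) * (+ 2 * t)) - (+ 8 * δ + + 2) * (+ 8 * w + 1ℤ) + + 2 ≡
                      (+ 2 * (t * t) - δ * (+ 8 * w + 1ℤ) - + 2 * w) * + 8
    lemma = solve-∀

-- Turns an equation that fails modulo m into a false divisibility between numbers, which `from-no`
-- can refute.
∣-remainder : ∀ {L R m} q c → L ≡ R → L - R ≡ q * m - c → m ∣ c
∣-remainder {L} {_} {m} q c refl eq = divides q (begin
  c                      ≡⟨ pad c L ⟩
  c + (L - L)            ≡⟨ cong (λ x → c + x) eq ⟩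
  c + (q * m - c)        ≡⟨ cancel c (q * m) ⟩
  q * m                  ∎)
  where
  open ≡-Reasoning
  pad : ∀ c L → c ≡ c + (L - L)
  pad = solve-∀
  cancel : ∀ c x → c + (x - c) ≡ x
  cancel = solve-∀

-- Let d = 8 g + 2. If g ≡ 0 modulo 3, then p² + q² ≡ 0, so 3 divides p and q, although 9 does not
-- divide 6. If g ≡ 2, then 3 ∣ d and x² ≡ -1 modulo 3.
10mod24 : ∀ g x y p q → x * x - (+ 8 * g + + 2) * (y * y) ≡ - 1ℤ → p * p - (+ 8 * g + + 2) * (q * q) ≡ + 6 →
          ∃ λ δ → + 8 * g + + 2 ≡ + 24 * δ + + 10
10mod24 g x y p q pell six with residue₃ g
... | t , inj₂ (inj₁ refl) = t , lemma t
  where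
  lemma : ∀ t → + 8 * (+ 3 * t + 1ℤ) + + 2 ≡ + 24 * t + + 10
  lemma = solve-∀
... | t , inj₁ refl with square₃ p | square₃ q
...   | inj₁ (u , refl) | inj₁ (v , refl) = contradiction
  (∣-remainder (u * u - (+ 24 * t + + 2) * (v * v)) (+ 6) six (lemma t u v)) (from-no (+ 9 ∣? + 6))
  where
  lemma : ∀ t u v → (+ 3 * u) * (+ 3 * u) - (+ 8 * (+ 3 * t) + + 2) * ((+ 3 * v) * (+ 3 * v)) - + 6 ≡ (u * u - (+ 24 * t + + 2) * (v * v)) * + 9 - + 6
  lemma = solve-∀
...   | inj₁ (u , refl) | inj₂ (w , qq) = contradiction
  (∣-remainder (+ 3 * (u * u) - + 8 * t * (+ 3 * w + 1ℤ) - + 2 * w - + 2) (+ 2)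
    (trans (cong (λ s → (+ 3 * u) * (+ 3 * u) - (+ 8 * (+ 3 * t) + + 2) * s) (sym qq)) six) (lemma t u w)) (from-no (+ 3 ∣? + 2))
  where
  lemma : ∀ t u w → (+ 3 * u) * (+ 3 * u) - (+ 8 * (+ 3 * t) + + 2) * (+ 3 * w + 1ℤ) - + 6 ≡
                    (+ 3 * (u * u) - + 8 * t * (+ 3 * w + 1ℤ) - + 2 * w - + 2) * + 3 - + 2
  lemma = solve-∀
...   | inj₂ (w , pp) | inj₁ (v , refl) = contradiction
  (∣-remainder (w - (+ 24 * t + + 2) * (+ 3 * (v * v)) - 1ℤ) (+ 2)
    (trans (cong (λ s → s - (+ 8 * (+ 3 * t) + + 2) * ((+ 3 * v) * (+ 3 * v))) (sym pp)) six) (lemma t v w)) (from-no (+ 3 ∣? + 2))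
  where
  lemma : ∀ t v w → + 3 * w + 1ℤ - (+ 8 * (+ 3 * t) + + 2) * ((+ 3 * v) * (+ 3 * v)) - + 6 ≡
                    (w - (+ 24 * t + + 2) * (+ 3 * (v * v)) - 1ℤ) * + 3 - + 2
  lemma = solve-∀
...   | inj₂ (w , pp) | inj₂ (w′ , qq) = contradiction
  (∣-remainder (w - + 8 * t * (+ 3 * w′ + 1ℤ) - + 2 * w′ - + 2) 1ℤ
    (trans (cong₂ (λ r s → r - (+ 8 * (+ 3 * t) + + 2) * s) (sym pp) (sym qq)) six) (lemma t w w′)) (from-no (+ 3 ∣? 1ℤ))
  where
  lemma : ∀ t w w′ → + 3 * w + 1ℤ - (+ 8 * (+ 3 * t) + + 2) * (+ 3 * w′ + 1ℤ) - + 6 ≡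
                     (w - + 8 * t * (+ 3 * w′ + 1ℤ) - + 2 * w′ - + 2) * + 3 - 1ℤ
  lemma = solve-∀
10mod24 g x y p q pell six | t , inj₂ (inj₂ refl) with square₃ x
... | inj₁ (u , refl) = contradiction
  (∣-remainder (+ 3 * (u * u) - (+ 8 * t + + 6) * (y * y) + 1ℤ) (+ 2) pell (lemma t u y)) (from-no (+ 3 ∣? + 2))
  where
  lemma : ∀ t u y → (+ 3 * u) * (+ 3 * u) - (+ 8 * (+ 3 * t + + 2) + + 2) * (y * y) - - 1ℤ ≡
                    (+ 3 * (u * u) - (+ 8 * t + + 6) * (y * y) + 1ℤ) * + 3 - + 2
  lemma = solve-∀
... | inj₂ (w , xx) = contradiction
  (∣-remainder (w - (+ 8 * t + + 6) * (y * y) + 1ℤ) 1ℤ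
    (trans (cong (λ s → s - (+ 8 * (+ 3 * t + + 2) + + 2) * (y * y)) (sym xx)) pell) (lemma t w y)) (from-no (+ 3 ∣? 1ℤ))
  where
  lemma : ∀ t w y → + 3 * w + 1ℤ - (+ 8 * (+ 3 * t + + 2) + + 2) * (y * y) - - 1ℤ ≡
                    (w - (+ 8 * t + + 6) * (y * y) + 1ℤ) * + 3 - 1ℤ
  lemma = solve-∀

-- The equation reads p² ≡ q² modulo 3, so 3 ∣ p would give 3 ∣ q and then 9 ∣ 6 e.
norm≡6e⇒p*p≡1 : ∀ δ p q e → p * p - (+ 24 * δ + + 10) * (q * q) ≡ e * + 6 → ¬ (+ 9 ∣ e * + 6) → ∃ λ w → p * p ≡ + 3 * w + 1ℤ
norm≡6e⇒p*p≡1 δ p q e N 9∤6e with square₃ p | square₃ q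
... | inj₂ pp | _ = pp
... | inj₁ (u , refl) | inj₁ (v , refl) = contradiction
  (∣-remainder (u * u - (+ 24 * δ + + 10) * (v * v)) (e * + 6) N (lemma δ u v e)) 9∤6e
  where
  lemma : ∀ δ u v e → (+ 3 * u) * (+ 3 * u) - (+ 24 * δ + + 10) * ((+ 3 * v) * (+ 3 * v)) - e * + 6 ≡
                      (u * u - (+ 24 * δ + + 10) * (v * v)) * + 9 - e * + 6
  lemma = solve-∀
... | inj₁ (u , refl) | inj₂ (w , qq) = contradiction
  (∣-remainder (+ 3 * (u * u) - + 8 * δ * (+ 3 * w + 1ℤ) - + 10 * w - + 2 * e - + 3) 1ℤ
    (trans (cong (λ s → (+ 3 * u) * (+ 3 * u) - (+ 24 * δ + + 10) * s) (sym qq)) N) (lemma δ u w e)) (from-no (+ 3 ∣? 1ℤ))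
  where
  lemma : ∀ δ u w e → (+ 3 * u) * (+ 3 * u) - (+ 24 * δ + + 10) * (+ 3 * w + 1ℤ) - e * + 6 ≡
                      (+ 3 * (u * u) - + 8 * δ * (+ 3 * w + 1ℤ) - + 10 * w - + 2 * e - + 3) * + 3 - 1ℤ
  lemma = solve-∀

3∣xy⇒ : ∀ x y → + 3 ∣ x * y → (+ 3 ∣ x) ⊎ (+ 3 ∣ y)
3∣xy⇒ x y 3∣xy = Sum.map ∣ᵤ⇒∣ ∣ᵤ⇒∣
  (euclidsLemma (∣ x ∣) (∣ y ∣) (from-yes (prime? 3)) (subst (3 ℕ.∣_) (abs-* x y) (∣⇒∣ᵤ 3∣xy)))

-- As d ≡ 1 modulo 3, the product (p + q)(p - q) is congruent to the norm. The alternatives are the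
-- primes above 3 given by √d ↦ 1 and √d ↦ -1.
norm≡6e⇒3∣p±q : ∀ δ p q e → p * p - (+ 24 * δ + + 10) * (q * q) ≡ e * + 6 → (+ 3 ∣ p + q) ⊎ (+ 3 ∣ p + - q)
norm≡6e⇒3∣p±q δ p q e N = 3∣xy⇒ (p + q) (p + - q)
  (divides (+ 2 * e + (+ 8 * δ + + 3) * (q * q)) (begin
    (p + q) * (p + - q)                                                   ≡⟨ factor δ p q ⟩
    p * p - (+ 24 * δ + + 10) * (q * q) + (+ 24 * δ + + 9) * (q * q)      ≡⟨ cong (λ t → t + (+ 24 * δ + + 9) * (q * q)) N ⟩
    e * + 6 + (+ 24 * δ + + 9) * (q * q)                                  ≡⟨ collect δ q e ⟩
    (+ 2 * e + (+ 8 * δ + + 3) * (q * q)) * + 3                           ∎))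
  where
  open ≡-Reasoning
  factor : ∀ δ p q → (p + q) * (p + - q) ≡ p * p - (+ 24 * δ + + 10) * (q * q) + (+ 24 * δ + + 9) * (q * q)
  factor = solve-∀
  collect : ∀ δ q e → e * + 6 + (+ 24 * δ + + 9) * (q * q) ≡ (+ 2 * e + (+ 8 * δ + + 3) * (q * q)) * + 3
  collect = solve-∀

-- Solutions for the residue classes of m and k

-- The coordinates of half of (2 ρ + κ√d)² − n, where d = 24 δ + 10.
half-re : (δ e M ρ κ : ℤ) → ℤ
half-re δ e M ρ κ = + 2 * (ρ * ρ) + (+ 12 * δ + + 5) * (κ * κ) - e * (+ 2 * M + 1ℤ)

half-im : (e K ρ κ : ℤ) → ℤ
half-im e K ρ κ = + 2 * (ρ * κ) - + 2 * (e * K)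

module _ {d : ℕ} where

  conj-⊗ : (z w : ℤ[√ d ]) → conj (z ⊗ w) ≡ conj z ⊗ conj w
  conj-⊗ (a +√d· b) (a′ +√d· b′) = ext (re-eq (+ d) a b a′ b′) (im-eq a b a′ b′)
    where
    re-eq : ∀ d a b a′ b′ → a * a′ + d * (b * b′) ≡ a * a′ + d * (- b * - b′)
    re-eq = solve-∀
    im-eq : ∀ a b a′ b′ → - (a * b′ + b * a′) ≡ a * - b′ + - b * a′
    im-eq = solve-∀

  conj-⊕ : (z w : ℤ[√ d ]) → conj (z ⊕ w) ≡ conj z ⊕ conj w
  conj-⊕ (a +√d· b) (a′ +√d· b′) = ext refl (ℤ.neg-distrib-+ b b′)

  height-conj : (z : ℤ[√ d ]) → height (conj z) ≡ height z
  height-conj (a +√d· b) = cong (∣ a ∣ ℕ.+_) (∣-i∣≡∣i∣ b)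

  conj-Solution : {a n s : ℤ[√ d ]} → Solution a n s → Solution (conj a) (conj n) (conj s)
  conj-Solution {a} {n} {s} (solution b r z e₁ e₂ e₃) = solution (conj b) (conj r) (conj z)
    (begin
      conj a ⊗ conj b ⊕ conj n ≡⟨ cong (_⊕ conj n) (conj-⊗ a b) ⟨
      conj (a ⊗ b) ⊕ conj n    ≡⟨ conj-⊕ (a ⊗ b) n ⟨
      conj (a ⊗ b ⊕ n)         ≡⟨ cong conj e₁ ⟩
      conj (r ⊗ r)             ≡⟨ conj-⊗ r r ⟩
      conj r ⊗ conj r          ∎)
    (begin
      (conj a ⊕ # 2 ⊗ conj r) ⊗ (conj a ⊕ # 2 ⊗ conj r) ≡⟨ cong₂ _⊗_ conj-T conj-T ⟨
      conj T ⊗ conj T                                                  ≡⟨ conj-⊗ T T ⟨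
      conj (T ⊗ T)                                                     ≡⟨ cong conj e₂ ⟩
      conj (z ⊗ z ⊕ # 3 ⊗ n)                                   ≡⟨ conj-⊕ (z ⊗ z) (# 3 ⊗ n) ⟩
      conj (z ⊗ z) ⊕ conj (# 3 ⊗ n)                            ≡⟨ cong₂ _⊕_ (conj-⊗ z z) (conj-⊗ (# 3) n) ⟩
      conj z ⊗ conj z ⊕ # 3 ⊗ conj n                           ∎)
    (trans (cong conj e₃) (trans (conj-⊕ T z) (cong (_⊕ conj z) conj-T)))
    where
    open ≡-Reasoning
    T = a ⊕ # 2 ⊗ r
    conj-T : conj T ≡ conj a ⊕ # 2 ⊗ conj r
    conj-T = trans (conj-⊕ a (# 2 ⊗ r)) (cong (conj a ⊕_) (conj-⊗ (# 2) r))

  -- The parameters in the notation of the theorem are (m , k) = (M , K) for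
  -- e = 1, and (m , k) = (- M - 1 , - K) for e = - 1.
  target : (e M K : ℤ) → ℤ[√ d ]
  target e M K = e * (+ 4 * M + + 2) +√d· e * (+ 4 * K)

  module _ (δ : ℤ) (d≡ : + d ≡ + 24 * δ + + 10) (e M K : ℤ) {p q : ℤ} where

    -- s = p + q√d divides 3 n, because 3 n = s s̄ (2 M + 1 + 2 K√d); the element
    -- T is half the sum of s and its cofactor.
    mkSolution : ∀ {α β} ρ κ b₁ b₂ →
      p * p - (+ 24 * δ + + 10) * (q * q) ≡ e * + 6 →
      (M + 1ℤ) * p - K * ((+ 24 * δ + + 10) * q) ≡ α + + 4 * ρ →
      K * p - M * q ≡ β + + 2 * κ →
      α * b₁ + (+ 24 * δ + + 10) * (β * b₂) ≡ + 2 * half-re δ e M ρ κ →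
      α * b₂ + β * b₁ ≡ + 2 * half-im e K ρ κ →
      Solution (α +√d· β) (target e M K) (p +√d· q)
    mkSolution {α} {β} ρ κ b₁ b₂ N T₁≡ T₂≡ re≡ im≡ = solution (b₁ +√d· b₂) r z
      (ext (trans (cong (λ D → α * b₁ + D * (β * b₂) + e * (+ 4 * M + + 2)) d≡)
             (trans (cong (λ t → t + e * (+ 4 * M + + 2)) re≡)
             (trans (re-r δ ρ κ e M) (cong (λ D → (+ 2 * ρ) * (+ 2 * ρ) + D * (κ * κ)) (sym d≡)))))
           (trans (cong (λ t → t + e * (+ 4 * K)) im≡) (im-r ρ κ e K)))
      (begin
        T′ ⊗ T′                        ≡⟨ cong₂ _⊗_ T≡ T≡ ⟨
        T ⊗ T                          ≡⟨ ext (trans (re-sq (+ d) M K p q) (cong (λ t → re (z ⊗ z) + t) re-N))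
                                              (trans (im-sq (+ d) M K p q) (cong (λ t → im (z ⊗ z) + t) im-N)) ⟩
        z ⊗ z ⊕ # 3 ⊗ target e M K  ∎)
      (begin
        p +√d· q            ≡⟨ solve 2 (λ s T → s := T :+ (s :+ :- T)) refl s T ⟩
        T ⊕ z               ≡⟨ cong (_⊕ z) T≡ ⟩
        T′ ⊕ z              ∎)
      where
      open ≡-Reasoning
      open ℤ[√]-Solver {d} using (solve; _:=_; _:+_; :-_)
      s T z r T′ : ℤ[√ d ]
      s = p +√d· q
      T = (M + 1ℤ) * p - K * (+ d * q) +√d· K * p - M * q
      -- Half the difference of s and its cofactor, so that T² - z² is their product.
      z = s ⊕ ⊝ T
      -- Every a in use lies in the prime above 2, as do n and √d; so a ∣ r² - n requires an even
      -- first coordinate of r.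
      r = + 2 * ρ +√d· κ
      T′ = (α +√d· β) ⊕ # 2 ⊗ r
      N′ : norm s ≡ e * + 6
      N′ = trans (cong (λ D → p * p - D * (q * q)) d≡) N
      T≡ : T ≡ T′
      T≡ = ext (trans (cong (λ D → (M + 1ℤ) * p - K * (D * q)) d≡) (trans T₁≡ (re-2r (+ d) α ρ κ)))
               (trans T₂≡ (im-2r β ρ κ))
        where
        re-2r : ∀ d α ρ κ → α + + 4 * ρ ≡ α + (+ 2 * (+ 2 * ρ) + d * (0ℤ * κ))
        re-2r = solve-∀
        im-2r : ∀ β ρ κ → β + + 2 * κ ≡ β + (+ 2 * κ + 0ℤ * (+ 2 * ρ))
        im-2r = solve-∀
      re-r : ∀ δ ρ κ e M → + 2 * (+ 2 * (ρ * ρ) + (+ 12 * δ + + 5) * (κ * κ) - e * (+ 2 * M + 1ℤ)) + e * (+ 4 * M + + 2) ≡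
                           (+ 2 * ρ) * (+ 2 * ρ) + (+ 24 * δ + + 10) * (κ * κ)
      re-r = solve-∀
      im-r : ∀ ρ κ e K → + 2 * (+ 2 * (ρ * κ) - + 2 * (e * K)) + e * (+ 4 * K) ≡ (+ 2 * ρ) * κ + κ * (+ 2 * ρ)
      im-r = solve-∀
      re-sq : ∀ d M K p q → let T₁ = (M + 1ℤ) * p - K * (d * q); T₂ = K * p - M * q in
        T₁ * T₁ + d * (T₂ * T₂) ≡ (p + - T₁) * (p + - T₁) + d * ((q + - T₂) * (q + - T₂)) + (p * p - d * (q * q)) * (+ 2 * M + 1ℤ)
      re-sq = solve-∀
      im-sq : ∀ d M K p q → let T₁ = (M + 1ℤ) * p - K * (d * q); T₂ = K * p - M * q in
        T₁ * T₂ + T₂ * T₁ ≡ (p + - T₁) * (q + - T₂) + (q + - T₂) * (p + - T₁) + (p * p - d * (q * q)) * (+ 2 * K)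
      im-sq = solve-∀
      re-N : norm s * (+ 2 * M + 1ℤ) ≡ + 3 * (e * (+ 4 * M + + 2)) + + d * (0ℤ * (e * (+ 4 * K)))
      re-N = trans (cong (_* (+ 2 * M + 1ℤ)) N′) (lemma (+ d) e M K)
        where
        lemma : ∀ d e M K → e * + 6 * (+ 2 * M + 1ℤ) ≡ + 3 * (e * (+ 4 * M + + 2)) + d * (0ℤ * (e * (+ 4 * K)))
        lemma = solve-∀
      im-N : norm s * (+ 2 * K) ≡ + 3 * (e * (+ 4 * K)) + 0ℤ * (e * (+ 4 * M + + 2))
      im-N = trans (cong (_* (+ 2 * K)) N′) (lemma e M K)
        where
        lemma : ∀ e M K → e * + 6 * (+ 2 * K) ≡ + 3 * (e * (+ 4 * K)) + 0ℤ * (e * (+ 4 * M + + 2))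
        lemma = solve-∀

module _ {d : ℕ} (δ : ℤ) (d≡ : + d ≡ + 24 * δ + + 10) where

  -- For a = 2 the quotient (r² - n) / 2 is always integral, so only the residues of T matter.
  mkSolution-2 : ∀ e M K {p q} ρ κ → p * p - (+ 24 * δ + + 10) * (q * q) ≡ e * + 6 →
            (M + 1ℤ) * p - K * ((+ 24 * δ + + 10) * q) ≡ + 2 + + 4 * ρ →
            K * p - M * q ≡ 0ℤ + + 2 * κ →
            Solution {d} (# 2) (target e M K) (p +√d· q)
  mkSolution-2 e M K ρ κ N T₁≡ T₂≡ = mkSolution δ d≡ e M K ρ κ g₁ g₂ N T₁≡ T₂≡ (re-eq δ g₁ g₂) (im-eq g₁ g₂)
    where
    g₁ = half-re δ e M ρ κ
    g₂ = half-im e K ρ κ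
    re-eq : ∀ δ g₁ g₂ → + 2 * g₁ + (+ 24 * δ + + 10) * (0ℤ * g₂) ≡ + 2 * g₁
    re-eq = solve-∀
    im-eq : ∀ g₁ g₂ → + 2 * g₂ + 0ℤ * g₁ ≡ + 2 * g₂
    im-eq = solve-∀

  -- Since 4 ∣ p, the first coordinate of T is -k d q modulo 4, which is 2 because k and q are odd.
  mkSolution-2₊ : ∀ P v M K → let p = + 4 * P; q = + 2 * v + 1ℤ in
    p * p - (+ 24 * δ + + 10) * (q * q) ≡ 1ℤ * + 6 →
    Solution {d} (# 2) (target 1ℤ (+ 2 * M) (+ 2 * K + 1ℤ)) (p +√d· q)
  mkSolution-2₊ P v M K N = mkSolution-2 1ℤ (+ 2 * M) (+ 2 * K + 1ℤ)
    -- These are (T₁ - 2) / 4 and T₂ / 2 for T = T₁ + T₂√d, with (2 K + 1)(2 v + 1) written as 2 X +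
    -- 1 for X = 2 K v + K + v.
    ((+ 2 * M + 1ℤ) * P - (+ 12 * δ * (+ 2 * (K * v) + K + v) + + 6 * δ + + 5 * (+ 2 * (K * v) + K + v) + + 3))
    ((+ 2 * K + 1ℤ) * (+ 2 * P) - M * (+ 2 * v + 1ℤ)) N (T₁-eq δ P v M K) (T₂-eq P v M K)
    where
    T₁-eq : ∀ δ P v M K → (+ 2 * M + 1ℤ) * (+ 4 * P) - (+ 2 * K + 1ℤ) * ((+ 24 * δ + + 10) * (+ 2 * v + 1ℤ)) ≡
      + 2 + + 4 * ((+ 2 * M + 1ℤ) * P - (+ 12 * δ * (+ 2 * (K * v) + K + v) + + 6 * δ + + 5 * (+ 2 * (K * v) + K + v) + + 3))
    T₁-eq = solve-∀
    T₂-eq : ∀ P v M K → (+ 2 * K + 1ℤ) * (+ 4 * P) - + 2 * M * (+ 2 * v + 1ℤ) ≡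
      0ℤ + + 2 * ((+ 2 * K + 1ℤ) * (+ 2 * P) - M * (+ 2 * v + 1ℤ))
    T₂-eq = solve-∀

  -- Now the term with d vanishes modulo 4, so p ≡ 2 is needed, which is why s has norm -6.
  mkSolution-2₋ : ∀ P v M K → let p = + 4 * P + + 2; q = + 2 * v + 1ℤ in
    p * p - (+ 24 * δ + + 10) * (q * q) ≡ - 1ℤ * + 6 →
    Solution {d} (# 2) (target (- 1ℤ) (+ 2 * M) (+ 2 * K)) (p +√d· q)
  mkSolution-2₋ P v M K N = mkSolution-2 (- 1ℤ) (+ 2 * M) (+ 2 * K)
    ((+ 2 * M + 1ℤ) * P + M - K * (+ 12 * δ + + 5) * (+ 2 * v + 1ℤ))
    (K * (+ 4 * P + + 2) - M * (+ 2 * v + 1ℤ)) N (T₁-eq δ P v M K) (T₂-eq P v M K)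
    where
    T₁-eq : ∀ δ P v M K → (+ 2 * M + 1ℤ) * (+ 4 * P + + 2) - + 2 * K * ((+ 24 * δ + + 10) * (+ 2 * v + 1ℤ)) ≡
      + 2 + + 4 * ((+ 2 * M + 1ℤ) * P + M - K * (+ 12 * δ + + 5) * (+ 2 * v + 1ℤ))
    T₁-eq = solve-∀
    T₂-eq : ∀ P v M K → + 2 * K * (+ 4 * P + + 2) - + 2 * M * (+ 2 * v + 1ℤ) ≡
      0ℤ + + 2 * (K * (+ 4 * P + + 2) - M * (+ 2 * v + 1ℤ))
    T₂-eq = solve-∀

  -- For a = 4 the first coordinate 4 ρ² + d κ² - n₁ of r² - n, where n₁ ≡ 2 modulo 4 is that of n,
  -- is divisible by 4 exactly when κ is odd. Here 2 κ ≡ -(4 M + 2) q ≡ 2 modulo 4.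
  mkSolution-4₊ : ∀ P v M K → let p = + 4 * P; q = + 2 * v + 1ℤ in
    p * p - (+ 24 * δ + + 10) * (q * q) ≡ 1ℤ * + 6 →
    Solution {d} (# 4) (target 1ℤ (+ 4 * M + + 2) (+ 2 * K)) (p +√d· q)
  mkSolution-4₊ P v M K N = mkSolution δ d≡ 1ℤ (+ 4 * M + + 2) (+ 2 * K) ρ (+ 2 * κ′ + 1ℤ)
    -- b is half of `half-re` and `half-im`, expanded at κ = 2 κ′ + 1.
    (ρ * ρ + + 2 * (+ 12 * δ + + 5) * (κ′ * κ′ + κ′) + + 6 * δ + + 2 - (+ 4 * M + + 2))
    (ρ * (+ 2 * κ′ + 1ℤ) - + 2 * K) N
    (T₁-eq δ P v M K) (T₂-eq P v M K) (re-eq δ ρ κ′ M (ρ * (+ 2 * κ′ + 1ℤ) - + 2 * K)) (im-eq δ ρ κ′ M K)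
    where
    ρ = (+ 4 * M + + 3) * P - K * (+ 12 * δ + + 5) * (+ 2 * v + 1ℤ) - 1ℤ
    κ′ = + 2 * (K * P) - M * (+ 2 * v + 1ℤ) - v - 1ℤ
    T₁-eq : ∀ δ P v M K → (+ 4 * M + + 2 + 1ℤ) * (+ 4 * P) - + 2 * K * ((+ 24 * δ + + 10) * (+ 2 * v + 1ℤ)) ≡
      + 4 + + 4 * ((+ 4 * M + + 3) * P - K * (+ 12 * δ + + 5) * (+ 2 * v + 1ℤ) - 1ℤ)
    T₁-eq = solve-∀
    T₂-eq : ∀ P v M K → + 2 * K * (+ 4 * P) - (+ 4 * M + + 2) * (+ 2 * v + 1ℤ) ≡
      0ℤ + + 2 * (+ 2 * (+ 2 * (K * P) - M * (+ 2 * v + 1ℤ) - v - 1ℤ) + 1ℤ)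
    T₂-eq = solve-∀
    re-eq : ∀ δ ρ κ′ M b₂ → + 4 * (ρ * ρ + + 2 * (+ 12 * δ + + 5) * (κ′ * κ′ + κ′) + + 6 * δ + + 2 - (+ 4 * M + + 2)) + (+ 24 * δ + + 10) * (0ℤ * b₂) ≡
      + 2 * (+ 2 * (ρ * ρ) + (+ 12 * δ + + 5) * ((+ 2 * κ′ + 1ℤ) * (+ 2 * κ′ + 1ℤ)) - 1ℤ * (+ 2 * (+ 4 * M + + 2) + 1ℤ))
    re-eq = solve-∀
    im-eq : ∀ δ ρ κ′ M K → + 4 * (ρ * (+ 2 * κ′ + 1ℤ) - + 2 * K) +
      0ℤ * (ρ * ρ + + 2 * (+ 12 * δ + + 5) * (κ′ * κ′ + κ′) + + 6 * δ + + 2 - (+ 4 * M + + 2)) ≡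
      + 2 * (+ 2 * (ρ * (+ 2 * κ′ + 1ℤ)) - + 2 * (1ℤ * (+ 2 * K)))
    im-eq = solve-∀

  -- Again κ must be odd; this time the term (2 K + 1) p ≡ 2 modulo 4 makes it so.
  mkSolution-4₋ : ∀ P v M K → let p = + 4 * P + + 2; q = + 2 * v + 1ℤ in
    p * p - (+ 24 * δ + + 10) * (q * q) ≡ - 1ℤ * + 6 →
    Solution {d} (# 4) (target (- 1ℤ) (+ 4 * M) (+ 2 * K + 1ℤ)) (p +√d· q)
  mkSolution-4₋ P v M K N = mkSolution δ d≡ (- 1ℤ) (+ 4 * M) (+ 2 * K + 1ℤ) ρ (+ 2 * κ′ + 1ℤ)
    (ρ * ρ + + 2 * (+ 12 * δ + + 5) * (κ′ * κ′ + κ′) + + 6 * δ + + 3 + + 4 * M)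
    (ρ * (+ 2 * κ′ + 1ℤ) + (+ 2 * K + 1ℤ)) N
    (T₁-eq δ P v M K) (T₂-eq P v M K) (re-eq δ ρ κ′ M (ρ * (+ 2 * κ′ + 1ℤ) + (+ 2 * K + 1ℤ))) (im-eq δ ρ κ′ M K)
    where
    X = + 2 * (K * v) + K + v
    ρ = + 4 * (M * P) + + 2 * M + P - + 12 * δ * X - + 6 * δ - + 5 * X - + 3
    κ′ = + 2 * (K * P) + K + P - M * (+ 2 * v + 1ℤ)
    T₁-eq : ∀ δ P v M K → let X = + 2 * (K * v) + K + v in
      (+ 4 * M + 1ℤ) * (+ 4 * P + + 2) - (+ 2 * K + 1ℤ) * ((+ 24 * δ + + 10) * (+ 2 * v + 1ℤ)) ≡
      + 4 + + 4 * (+ 4 * (M * P) + + 2 * M + P - + 12 * δ * X - + 6 * δ - + 5 * X - + 3)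
    T₁-eq = solve-∀
    T₂-eq : ∀ P v M K → (+ 2 * K + 1ℤ) * (+ 4 * P + + 2) - + 4 * M * (+ 2 * v + 1ℤ) ≡
      0ℤ + + 2 * (+ 2 * (+ 2 * (K * P) + K + P - M * (+ 2 * v + 1ℤ)) + 1ℤ)
    T₂-eq = solve-∀
    re-eq : ∀ δ ρ κ′ M b₂ → + 4 * (ρ * ρ + + 2 * (+ 12 * δ + + 5) * (κ′ * κ′ + κ′) + + 6 * δ + + 3 + + 4 * M) + (+ 24 * δ + + 10) * (0ℤ * b₂) ≡
      + 2 * (+ 2 * (ρ * ρ) + (+ 12 * δ + + 5) * ((+ 2 * κ′ + 1ℤ) * (+ 2 * κ′ + 1ℤ)) - - 1ℤ * (+ 2 * (+ 4 * M) + 1ℤ))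
    re-eq = solve-∀
    im-eq : ∀ δ ρ κ′ M K → + 4 * (ρ * (+ 2 * κ′ + 1ℤ) + (+ 2 * K + 1ℤ)) +
      0ℤ * (ρ * ρ + + 2 * (+ 12 * δ + + 5) * (κ′ * κ′ + κ′) + + 6 * δ + + 3 + + 4 * M) ≡
      + 2 * (+ 2 * (ρ * (+ 2 * κ′ + 1ℤ)) - + 2 * (- 1ℤ * (+ 2 * K + 1ℤ)))
    im-eq = solve-∀

-- x + y√d ↦ x + y mod 3 is a ring homomorphism, as d ≡ 1 mod 3.  Here it kills
-- s and a, so that it maps r to p (1 − (M + K)) up to sign.
3∣re+im-half : ∀ δ e M K p w h h₂ α ρ κ Z → let q = + 3 * h - p; β = + 3 * h₂ - α; u = 1ℤ - (M + K) in
  p * p ≡ + 3 * w + 1ℤ →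
  (M + 1ℤ) * p - K * ((+ 24 * δ + + 10) * q) ≡ α + + 4 * ρ →
  K * p - M * q ≡ β + + 2 * κ →
  u * (u + e) ≡ + 3 * Z →
  ∃ λ G → + 3 * G ≡ half-re δ e M ρ κ + half-im e K ρ κ
3∣re+im-half δ e M K p w h h₂ α ρ κ Z pp≡ T₁≡ T₂≡ u≡ = G , sym (begin
  half-re δ e M ρ κ + half-im e K ρ κ
    -- With ρ ≡ κ + p u, the image of r² - n is p² u² + e u, and p² ≡ 1 leaves u (u + e). Halving is
    -- multiplication by 2 modulo 3.
    ≡⟨ cong (λ x → half-re δ e M x κ + half-im e K x κ) ρ≡ ⟩
  half-re δ e M (κ + p * u + + 3 * X) κ + half-im e K (κ + p * u + + 3 * X) κ
    ≡⟨ expand δ e M K p X κ ⟩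
  + 3 * G₀ + + 2 * (u * u) * (p * p - 1ℤ) + + 2 * (u * (u + e))
    ≡⟨ cong₂ (λ x y → + 3 * G₀ + + 2 * (u * u) * (x - 1ℤ) + + 2 * y) pp≡ u≡ ⟩
  + 3 * G₀ + + 2 * (u * u) * (+ 3 * w + 1ℤ - 1ℤ) + + 2 * (+ 3 * Z)
    ≡⟨ collect G₀ u w Z ⟩
  + 3 * G ∎)
  where
  open ≡-Reasoning
  D q β u X W G₀ G : ℤ
  D = + 24 * δ + + 10
  q = + 3 * h - p
  β = + 3 * h₂ - α
  u = 1ℤ - (M + K)
  X = (+ 8 * δ + + 3) * (K * p) - K * D * h - M * h + p - p * u - h₂ - ρ - κ
  W = p * u + + 3 * X
  G₀ = + 3 * (κ * κ) + + 2 * (κ * W) + + 4 * (p * u * X) + + 6 * (X * X) + + 4 * δ * (κ * κ) - e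
  G = G₀ + + 2 * (u * u) * w + + 2 * Z
  ρ≡ : ρ ≡ κ + p * u + + 3 * X
  -- Adding the equations for the two coordinates of T removes α, because α + β = 3 h₂, and leaves ρ
  -- - κ ≡ p u modulo 3.
  ρ≡ = begin
    ρ                                                                           ≡⟨ isolate ρ κ α h₂ ⟩
    κ + ((α + + 4 * ρ) + (β + + 2 * κ)) - + 3 * h₂ - + 3 * ρ - + 3 * κ          ≡⟨ cong₂ (λ x y → κ + (x + y) - + 3 * h₂ - + 3 * ρ - + 3 * κ) T₁≡ T₂≡ ⟨
    κ + (((M + 1ℤ) * p - K * (D * q)) + (K * p - M * q)) - + 3 * h₂ - + 3 * ρ - + 3 * κ ≡⟨ reduce δ M K p h h₂ ρ κ ⟩
    κ + p * u + + 3 * X                                                         ∎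
    where
    isolate : ∀ ρ κ α h₂ → ρ ≡ κ + ((α + + 4 * ρ) + ((+ 3 * h₂ - α) + + 2 * κ)) - + 3 * h₂ - + 3 * ρ - + 3 * κ
    isolate = solve-∀
    reduce : ∀ δ M K p h h₂ ρ κ → let D = + 24 * δ + + 10; q = + 3 * h - p; u = 1ℤ - (M + K) in
      κ + (((M + 1ℤ) * p - K * (D * q)) + (K * p - M * q)) - + 3 * h₂ - + 3 * ρ - + 3 * κ ≡
      κ + p * u + + 3 * ((+ 8 * δ + + 3) * (K * p) - K * D * h - M * h + p - p * u - h₂ - ρ - κ)
    reduce = solve-∀
  expand : ∀ δ e M K p X κ → let u = 1ℤ - (M + K); W = p * u + + 3 * X; ρ = κ + p * u + + 3 * X in
    + 2 * (ρ * ρ) + (+ 12 * δ + + 5) * (κ * κ) - e * (+ 2 * M + 1ℤ) + (+ 2 * (ρ * κ) - + 2 * (e * K)) ≡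
    + 3 * (+ 3 * (κ * κ) + + 2 * (κ * W) + + 4 * (p * u * X) + + 6 * (X * X) + + 4 * δ * (κ * κ) - e) +
    + 2 * (u * u) * (p * p - 1ℤ) + + 2 * (u * (u + e))
  expand = solve-∀
  collect : ∀ G₀ u w Z → + 3 * G₀ + + 2 * (u * u) * (+ 3 * w + 1ℤ - 1ℤ) + + 2 * (+ 3 * Z) ≡ + 3 * (G₀ + + 2 * (u * u) * w + + 2 * Z)
  collect = solve-∀

-- a b = 2 (g₁ + g₂√d) is solved by b = − e (g₁ + g₂√d) ā / 3.
divideBy : ∀ δ e α h₂ g₁ g₂ G → let D = + 24 * δ + + 10; β = + 3 * h₂ - α in
  e * e ≡ 1ℤ → α * α - D * (β * β) ≡ - e * + 6 → + 3 * G ≡ g₁ + g₂ →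
  ∃₂ λ b₁ b₂ → α * b₁ + D * (β * b₂) ≡ + 2 * g₁ × α * b₂ + β * b₁ ≡ + 2 * g₂
divideBy δ e α h₂ g₁ g₂ G ee≡1 N 3G≡ = b₁ , b₂ ,
  cancel g₁ (trans (triple-re δ e α h₂ g₁ g₂ G) (trans (cong (λ x → - e * (α * (α * x + + 3 * (+ 8 * δ + + 3) * (g₂ * α) - + 3 * D * (g₂ * h₂)) + D * (β * (α * x - + 3 * (g₁ * h₂))))) 3G≡) (factor-re δ e α h₂ g₁ g₂))) ,
  cancel g₂ (trans (triple-im δ e α h₂ g₁ g₂ G) (trans (cong (λ x → - e * (α * (α * x - + 3 * (g₁ * h₂)) + β * (α * x + + 3 * (+ 8 * δ + + 3) * (g₂ * α) - + 3 * D * (g₂ * h₂)))) 3G≡) (factor-im δ e α h₂ g₁ g₂)))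
  where
  D β b₁ b₂ : ℤ
  D = + 24 * δ + + 10
  β = + 3 * h₂ - α
  -- The division by 3 is possible because g₁ + g₂√d and ā lie in different primes above 3. It is
  -- carried out by substituting 3 G for g₁ + g₂, 3 h₂ - α for β and 3 (8 δ + 3) for D - 1.
  b₁ = - e * (α * G + (+ 8 * δ + + 3) * (g₂ * α) - D * (g₂ * h₂))
  b₂ = - e * (α * G - g₁ * h₂)
  cancel : ∀ g {x} → + 3 * x ≡ - e * ((α * α - D * (β * β)) * g) → x ≡ + 2 * g
  cancel g {x} 3x≡ = ℤ.*-cancelˡ-≡ (+ 3) x (+ 2 * g) (begin
    + 3 * x                                  ≡⟨ 3x≡ ⟩
    - e * ((α * α - D * (β * β)) * g)        ≡⟨ cong (λ N → - e * (N * g)) N ⟩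
    - e * (- e * + 6 * g)                    ≡⟨ square e g ⟩
    + 3 * (e * e * (+ 2 * g))                ≡⟨ cong (λ s → + 3 * (s * (+ 2 * g))) ee≡1 ⟩
    + 3 * (1ℤ * (+ 2 * g))                   ≡⟨ cong (+ 3 *_) (ℤ.*-identityˡ (+ 2 * g)) ⟩
    + 3 * (+ 2 * g)                          ∎)
    where
    open ≡-Reasoning
    square : ∀ e g → - e * (- e * + 6 * g) ≡ + 3 * (e * e * (+ 2 * g))
    square = solve-∀
  triple-re : ∀ δ e α h₂ g₁ g₂ G → let D = + 24 * δ + + 10; β = + 3 * h₂ - α in
    + 3 * (α * (- e * (α * G + (+ 8 * δ + + 3) * (g₂ * α) - D * (g₂ * h₂))) + D * (β * (- e * (α * G - g₁ * h₂)))) ≡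
    - e * (α * (α * (+ 3 * G) + + 3 * (+ 8 * δ + + 3) * (g₂ * α) - + 3 * D * (g₂ * h₂)) + D * (β * (α * (+ 3 * G) - + 3 * (g₁ * h₂))))
  triple-re = solve-∀
  factor-re : ∀ δ e α h₂ g₁ g₂ → let D = + 24 * δ + + 10; β = + 3 * h₂ - α in
    - e * (α * (α * (g₁ + g₂) + + 3 * (+ 8 * δ + + 3) * (g₂ * α) - + 3 * D * (g₂ * h₂)) + D * (β * (α * (g₁ + g₂) - + 3 * (g₁ * h₂)))) ≡
    - e * ((α * α - D * (β * β)) * g₁)
  factor-re = solve-∀
  triple-im : ∀ δ e α h₂ g₁ g₂ G → let D = + 24 * δ + + 10; β = + 3 * h₂ - α in
    + 3 * (α * (- e * (α * G - g₁ * h₂)) + β * (- e * (α * G + (+ 8 * δ + + 3) * (g₂ * α) - D * (g₂ * h₂)))) ≡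
    - e * (α * (α * (+ 3 * G) - + 3 * (g₁ * h₂)) + β * (α * (+ 3 * G) + + 3 * (+ 8 * δ + + 3) * (g₂ * α) - + 3 * D * (g₂ * h₂)))
  triple-im = solve-∀
  factor-im : ∀ δ e α h₂ g₁ g₂ → let D = + 24 * δ + + 10; β = + 3 * h₂ - α in
    - e * (α * (α * (g₁ + g₂) - + 3 * (g₁ * h₂)) + β * (α * (g₁ + g₂) + + 3 * (+ 8 * δ + + 3) * (g₂ * α) - + 3 * D * (g₂ * h₂))) ≡
    - e * ((α * α - D * (β * β)) * g₂)
  factor-im = solve-∀

complement : ∀ x y h → x + y ≡ h * + 3 → y ≡ + 3 * h - x
complement x y h eq = begin
  y              ≡⟨ add-sub x y ⟩
  x + y - x      ≡⟨ cong (λ t → t - x) eq ⟩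
  h * + 3 - x    ≡⟨ cong (λ t → t - x) (ℤ.*-comm h (+ 3)) ⟩
  + 3 * h - x    ∎
  where
  open ≡-Reasoning
  add-sub : ∀ x y → y ≡ x + y - x
  add-sub = solve-∀

module _ {d : ℕ} (δ : ℤ) (d≡ : + d ≡ + 24 * δ + + 10) where

  -- Divisibility of r² - n by a has a part at 2, settled by the even first coordinate of r, and a
  -- part at 3, where the condition on 1 - (M + K) expresses r² ≡ n.
  mkSolution-aligned : ∀ e M K {p q α β} ρ κ → e * e ≡ 1ℤ → ¬ (+ 9 ∣ e * + 6) →
    α * α - (+ 24 * δ + + 10) * (β * β) ≡ - e * + 6 →
    p * p - (+ 24 * δ + + 10) * (q * q) ≡ e * + 6 →
    + 3 ∣ α + β → + 3 ∣ p + q → + 3 ∣ (1ℤ - (M + K)) * (1ℤ - (M + K) + e) →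
    (M + 1ℤ) * p - K * ((+ 24 * δ + + 10) * q) ≡ α + + 4 * ρ →
    K * p - M * q ≡ β + + 2 * κ →
    Solution {d} (α +√d· β) (target e M K) (p +√d· q)
  mkSolution-aligned e M K {p} {q} {α} {β} ρ κ ee≡1 9∤6e Na N (divides h₂ α+β≡) (divides h p+q≡) (divides Z u≡) T₁≡ T₂≡
    with refl ← complement p q h p+q≡ | refl ← complement α β h₂ α+β≡ =
    let w , pp≡ = norm≡6e⇒p*p≡1 δ p (+ 3 * h - p) e N 9∤6e
        G , 3G≡ = 3∣re+im-half δ e M K p w h h₂ α ρ κ Z pp≡ T₁≡ T₂≡ (trans u≡ (ℤ.*-comm Z (+ 3)))
        b₁ , b₂ , re≡ , im≡ = divideBy δ e α h₂ (half-re δ e M ρ κ) (half-im e K ρ κ) G ee≡1 Na 3G≡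
    in mkSolution δ d≡ e M K ρ κ b₁ b₂ N T₁≡ T₂≡ re≡ im≡

module _ (δ : ℤ) where
  private
    8∣ : ∀ {c} p q → p * p - (+ 24 * δ + + 10) * (q * q) ≡ c → p * p - (+ 8 * (+ 3 * δ + 1ℤ) + + 2) * (q * q) ≡ c
    8∣ p q = trans (lemma δ p q)
      where
      lemma : ∀ δ p q → p * p - (+ 8 * (+ 3 * δ + 1ℤ) + + 2) * (q * q) ≡ p * p - (+ 24 * δ + + 10) * (q * q)
      lemma = solve-∀

  norm≡6⇒ : ∀ p q → p * p - (+ 24 * δ + + 10) * (q * q) ≡ + 6 → (∃ λ P → p ≡ + 4 * P) × Odd q
  norm≡6⇒ p q N = quarter N (evenNorm⇒ (+ 3 * δ + 1ℤ) p q (+ 3) (8∣ p q N) (from-no (+ 4 ∣? + 6)))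
    where
    lemma : ∀ P → + 2 * (+ 2 * P) ≡ + 4 * P
    lemma = solve-∀
    quarter : ∀ {p q} → p * p - (+ 24 * δ + + 10) * (q * q) ≡ + 6 → Even p × Odd q → (∃ λ P → p ≡ + 4 * P) × Odd q
    quarter N ((P , refl) , (v , refl)) =
      let P′ , P≡ = norm≡6⇒Even (+ 3 * δ + 1ℤ) P v (8∣ (+ 2 * P) (+ 2 * v + 1ℤ) N)
      in (P′ , trans (cong (+ 2 *_) P≡) (lemma P′)) , (v , refl)

  norm≡-6⇒ : ∀ p q → p * p - (+ 24 * δ + + 10) * (q * q) ≡ - + 6 → (∃ λ P → p ≡ + 4 * P + + 2) × Odd q
  norm≡-6⇒ p q N = quarter N (evenNorm⇒ (+ 3 * δ + 1ℤ) p q (- + 3) (8∣ p q N) (from-no (+ 4 ∣? - + 6)))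
    where
    lemma : ∀ P → + 2 * (+ 2 * P + 1ℤ) ≡ + 4 * P + + 2
    lemma = solve-∀
    quarter : ∀ {p q} → p * p - (+ 24 * δ + + 10) * (q * q) ≡ - + 6 → Even p × Odd q → (∃ λ P → p ≡ + 4 * P + + 2) × Odd q
    quarter N ((P , refl) , (v , refl)) =
      let P′ , P≡ = norm≡-6⇒Odd (+ 3 * δ + 1ℤ) P v (8∣ (+ 2 * P) (+ 2 * v + 1ℤ) N)
      in (P′ , trans (cong (+ 2 *_) P≡) (lemma P′)) , (v , refl)

module _ {d : ℕ} (δ : ℤ) (d≡ : + d ≡ + 24 * δ + + 10) where

  -- The first coordinate of T is -k d q ≡ 2 modulo 4, so α ≡ 2 is required. This is the shape of
  -- norm -6: a and s have norms of opposite sign.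
  mkSolution-aligned₊ : ∀ A B P v M K → let α = + 4 * A + + 2; β = + 2 * B + 1ℤ; p = + 4 * P; q = + 2 * v + 1ℤ; m = + 4 * M + 1ℤ; k = + 2 * K + 1ℤ in
    α * α - (+ 24 * δ + + 10) * (β * β) ≡ - + 6 → p * p - (+ 24 * δ + + 10) * (q * q) ≡ + 6 →
    + 3 ∣ α + β → + 3 ∣ p + q → + 3 ∣ (1ℤ - (m + k)) * (1ℤ - (m + k) + 1ℤ) →
    Solution {d} (α +√d· β) (target 1ℤ m k) (p +√d· q)
  mkSolution-aligned₊ A B P v M K Na N 3∣a 3∣s 3∣u = mkSolution-aligned δ d≡ 1ℤ (+ 4 * M + 1ℤ) (+ 2 * K + 1ℤ)
    (let X = + 2 * (K * v) + K + v in (+ 4 * M + + 2) * P - + 12 * δ * X - + 6 * δ - + 5 * X - + 3 - A)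
    ((+ 2 * K + 1ℤ) * (+ 2 * P) - + 2 * M * (+ 2 * v + 1ℤ) - v - 1ℤ - B)
    refl (from-no (+ 9 ∣? + 6)) Na N 3∣a 3∣s 3∣u (T₁-eq δ A P v M K) (T₂-eq B P v M K)
    where
    T₁-eq : ∀ δ A P v M K → let X = + 2 * (K * v) + K + v in
      (+ 4 * M + 1ℤ + 1ℤ) * (+ 4 * P) - (+ 2 * K + 1ℤ) * ((+ 24 * δ + + 10) * (+ 2 * v + 1ℤ)) ≡
      + 4 * A + + 2 + + 4 * ((+ 4 * M + + 2) * P - + 12 * δ * X - + 6 * δ - + 5 * X - + 3 - A)
    T₁-eq = solve-∀
    T₂-eq : ∀ B P v M K → (+ 2 * K + 1ℤ) * (+ 4 * P) - (+ 4 * M + 1ℤ) * (+ 2 * v + 1ℤ) ≡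
      + 2 * B + 1ℤ + + 2 * ((+ 2 * K + 1ℤ) * (+ 2 * P) - + 2 * M * (+ 2 * v + 1ℤ) - v - 1ℤ - B)
    T₂-eq = solve-∀

  -- The signs are exchanged: 4 divides m + 1 and k d, hence the first coordinate of T, so α ≡ 0
  -- modulo 4 and a has norm 6.
  mkSolution-aligned₋ : ∀ A B P v M K → let α = + 4 * A; β = + 2 * B + 1ℤ; p = + 4 * P + + 2; q = + 2 * v + 1ℤ; m = + 4 * M + + 3; k = + 2 * K in
    α * α - (+ 24 * δ + + 10) * (β * β) ≡ + 6 → p * p - (+ 24 * δ + + 10) * (q * q) ≡ - + 6 →
    + 3 ∣ α + β → + 3 ∣ p + q → + 3 ∣ (1ℤ - (m + k)) * (1ℤ - (m + k) + - 1ℤ) →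
    Solution {d} (α +√d· β) (target (- 1ℤ) m k) (p +√d· q)
  mkSolution-aligned₋ A B P v M K Na N 3∣a 3∣s 3∣u = mkSolution-aligned δ d≡ (- 1ℤ) (+ 4 * M + + 3) (+ 2 * K)
    ((M + 1ℤ) * (+ 4 * P + + 2) - K * (+ 12 * δ + + 5) * (+ 2 * v + 1ℤ) - A)
    (K * (+ 4 * P + + 2) - (+ 2 * M + 1ℤ) * (+ 2 * v + 1ℤ) - v - 1ℤ - B)
    refl (from-no (+ 9 ∣? - + 6)) Na N 3∣a 3∣s 3∣u (T₁-eq δ A P v M K) (T₂-eq B P v M K)
    where
    T₁-eq : ∀ δ A P v M K →
      (+ 4 * M + + 3 + 1ℤ) * (+ 4 * P + + 2) - + 2 * K * ((+ 24 * δ + + 10) * (+ 2 * v + 1ℤ)) ≡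
      + 4 * A + + 4 * ((M + 1ℤ) * (+ 4 * P + + 2) - K * (+ 12 * δ + + 5) * (+ 2 * v + 1ℤ) - A)
    T₁-eq = solve-∀
    T₂-eq : ∀ B P v M K → + 2 * K * (+ 4 * P + + 2) - (+ 4 * M + + 3) * (+ 2 * v + 1ℤ) ≡
      + 2 * B + 1ℤ + + 2 * (K * (+ 4 * P + + 2) - (+ 2 * M + 1ℤ) * (+ 2 * v + 1ℤ) - v - 1ℤ - B)
    T₂-eq = solve-∀

-- Infinite families of factors and the case distinction on (m , k)

LargeSolutions : ∀ {d} → ℤ[√ d ] → Set
LargeSolutions {d} n = ∃ λ (a : ℤ[√ d ]) → a ≢ 𝟘 × (∀ B → ∃ λ s → B ℕ.< height s × Solution a n s)

-- Replaces k by -k, which amounts to exchanging the two primes above 3.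
conj-LargeSolutions : ∀ {d} {n : ℤ[√ d ]} → LargeSolutions n → LargeSolutions (conj n)
conj-LargeSolutions {d} {n} (a , a≢𝟘 , large) = conj a , conj-a≢𝟘 , large′
  where
  conj-a≢𝟘 : conj a ≢ 𝟘
  conj-a≢𝟘 eq = a≢𝟘 (ext (cong re eq) (ℤ.neg-injective (cong im eq)))
  large′ : ∀ B → ∃ λ s → B ℕ.< height s × Solution (conj a) (conj n) s
  large′ B with s , B<s , sol ← large B = conj s , subst (B ℕ.<_) (sym (height-conj s)) B<s , conj-Solution sol

∤⇒∣[1-j][2-j] : ∀ j → ¬ (+ 3 ∣ j) → + 3 ∣ (1ℤ - j) * (1ℤ - j + 1ℤ)
∤⇒∣[1-j][2-j] j 3∤j with residue₃ j
... | t , inj₁ refl = contradiction (divides t (ℤ.*-comm (+ 3) t)) 3∤j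
... | t , inj₂ (inj₁ refl) = divides (- t * (1ℤ - + 3 * t)) (lemma t)
  where
  lemma : ∀ t → (1ℤ - (+ 3 * t + 1ℤ)) * (1ℤ - (+ 3 * t + 1ℤ) + 1ℤ) ≡ - t * (1ℤ - + 3 * t) * + 3
  lemma = solve-∀
... | t , inj₂ (inj₂ refl) = divides (- t * (- 1ℤ - + 3 * t)) (lemma t)
  where
  lemma : ∀ t → (1ℤ - (+ 3 * t + + 2)) * (1ℤ - (+ 3 * t + + 2) + 1ℤ) ≡ - t * (- 1ℤ - + 3 * t) * + 3
  lemma = solve-∀

-- The roots 0 and 1 leave out only j ≡ -1 modulo 3. For j = M + K and e = -1, the number -1 - j is
-- m + k in the notation of the theorem.
∤⇒∣[1-j]j : ∀ j → ¬ (+ 3 ∣ - 1ℤ - j) → + 3 ∣ (1ℤ - j) * (1ℤ - j + - 1ℤ)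
∤⇒∣[1-j]j j 3∤ with residue₃ j
... | t , inj₁ refl = divides ((1ℤ - + 3 * t) * - t) (lemma t)
  where
  lemma : ∀ t → (1ℤ - + 3 * t) * (1ℤ - + 3 * t + - 1ℤ) ≡ (1ℤ - + 3 * t) * - t * + 3
  lemma = solve-∀
... | t , inj₂ (inj₁ refl) = divides (t * (+ 3 * t + 1ℤ)) (lemma t)
  where
  lemma : ∀ t → (1ℤ - (+ 3 * t + 1ℤ)) * (1ℤ - (+ 3 * t + 1ℤ) + - 1ℤ) ≡ t * (+ 3 * t + 1ℤ) * + 3
  lemma = solve-∀
... | t , inj₂ (inj₂ refl) = contradiction (divides (- t - 1ℤ) (lemma t)) 3∤
  where
  lemma : ∀ t → - 1ℤ - (+ 3 * t + + 2) ≡ (- t - 1ℤ) * + 3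
  lemma = solve-∀

3∣x±y⇒ : ∀ x y → + 3 ∣ x + y → + 3 ∣ x - y → (+ 3 ∣ x) × (+ 3 ∣ y)
3∣x±y⇒ x y 3∣+ 3∣- =
  subst (+ 3 ∣_) (x-eq x y) (∣m∣n⇒∣m-n (∣m⇒∣m*n x ∣-refl) (∣m∣n⇒∣m+n 3∣+ 3∣-)) ,
  subst (+ 3 ∣_) (y-eq x y) (∣m∣n⇒∣m-n (∣m⇒∣m*n y ∣-refl) (∣m∣n⇒∣m-n 3∣+ 3∣-))
  where
  x-eq : ∀ x y → + 3 * x - ((x + y) + (x - y)) ≡ x
  x-eq = solve-∀
  y-eq : ∀ x y → + 3 * y - ((x + y) - (x - y)) ≡ y
  y-eq = solve-∀

module _ {d : ℕ} (0<d : 0 ℕ.< d) (δ : ℤ) (d≡ : + d ≡ + 24 * δ + + 10)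
         (ε ξ : ℤ[√ d ]) (norm-ε : norm ε ≡ - 1ℤ) (0<re-ε : 0 ℕ.< ∣ re ε ∣) (0<im-ε : 0 ℕ.< ∣ im ε ∣) (norm-ξ : norm ξ ≡ + 6)
         where

  unitMultiples : ∀ {a n} {c} (ζ : ℤ[√ d ]) → norm ζ ≡ c → 0 ℕ.< ∣ c ∣ → a ≢ 𝟘 →
                  (∀ u → norm (ζ ⊗ u) ≡ c → Solution a n (ζ ⊗ u)) → LargeSolutions n
  unitMultiples {a} {n} {c} ζ norm-ζ 0<c a≢𝟘 sol = a , a≢𝟘 , large
    where
    large : ∀ B → ∃ λ s → B ℕ.< height s × Solution a n s
    large B =
      let u , norm-u , B<ζu = tallUnitMultiple 0<d ε norm-ε 0<re-ε 0<im-ε ζ (subst (λ x → 0 ℕ.< ∣ x ∣) (sym norm-ζ) 0<c) B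
      in ζ ⊗ u , B<ζu , sol u (trans (norm-⊗ ζ u) (trans (cong₂ _*_ norm-ζ norm-u) (ℤ.*-identityʳ c)))

  norm-expand : ∀ {c} (z : ℤ[√ d ]) → norm z ≡ c → re z * re z - (+ 24 * δ + + 10) * (im z * im z) ≡ c
  norm-expand {c} z = subst (λ D → re z * re z - D * (im z * im z) ≡ c) d≡

  norm-ξ⊗ε : norm (ξ ⊗ ε) ≡ - + 6
  norm-ξ⊗ε = trans (norm-⊗ ξ ε) (cong₂ _*_ norm-ξ norm-ε)

  largeSolutions₊ : ∀ {a n} → a ≢ 𝟘 →
    (∀ P v → let p = + 4 * P; q = + 2 * v + 1ℤ in p * p - (+ 24 * δ + + 10) * (q * q) ≡ + 6 → Solution a n (p +√d· q)) →
    LargeSolutions n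
  largeSolutions₊ {a} {n} a≢𝟘 sol = unitMultiples ξ norm-ξ (s≤s z≤n) a≢𝟘 λ u N →
    let N′ = norm-expand (ξ ⊗ u) N in go (re (ξ ⊗ u)) (im (ξ ⊗ u)) N′ (norm≡6⇒ δ (re (ξ ⊗ u)) (im (ξ ⊗ u)) N′)
    where
    go : ∀ p q → p * p - (+ 24 * δ + + 10) * (q * q) ≡ + 6 → (∃ λ P → p ≡ + 4 * P) × Odd q → Solution a n (p +√d· q)
    go _ _ N ((P , refl) , (v , refl)) = sol P v N

  largeSolutions₋ : ∀ {a n} → a ≢ 𝟘 →
    (∀ P v → let p = + 4 * P + + 2; q = + 2 * v + 1ℤ in p * p - (+ 24 * δ + + 10) * (q * q) ≡ - + 6 → Solution a n (p +√d· q)) →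
    LargeSolutions n
  largeSolutions₋ {a} {n} a≢𝟘 sol = unitMultiples (ξ ⊗ ε) norm-ξ⊗ε (s≤s z≤n) a≢𝟘 λ u N →
    let N′ = norm-expand (ξ ⊗ ε ⊗ u) N in go (re (ξ ⊗ ε ⊗ u)) (im (ξ ⊗ ε ⊗ u)) N′ (norm≡-6⇒ δ (re (ξ ⊗ ε ⊗ u)) (im (ξ ⊗ ε ⊗ u)) N′)
    where
    go : ∀ p q → p * p - (+ 24 * δ + + 10) * (q * q) ≡ - + 6 → (∃ λ P → p ≡ + 4 * P + + 2) × Odd q → Solution a n (p +√d· q)
    go _ _ N ((P , refl) , (v , refl)) = sol P v N

  -- Conjugation keeps the norm and swaps the two primes above 3, so z or its conjugate lies in the
  -- one where √d ≡ 1.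
  aligned : ∀ e z → norm z ≡ e * + 6 → ∃ λ (a : ℤ[√ d ]) → norm a ≡ e * + 6 × + 3 ∣ re a + im a
  aligned e z N = Sum.[ (λ 3∣ → z , N , 3∣) , (λ 3∣ → conj z , trans (norm-conj z) N , 3∣) ]′
    (norm≡6e⇒3∣p±q δ (re z) (im z) e (norm-expand z N))

  -- The condition defines an ideal, the kernel of √d ↦ 1 modulo 3.
  aligned-⊗ : ∀ (a w : ℤ[√ d ]) → + 3 ∣ re a + im a → + 3 ∣ re (a ⊗ w) + im (a ⊗ w)
  aligned-⊗ (α +√d· β) (x +√d· y) 3∣ = subst (+ 3 ∣_)
    (trans (φ-⊗ δ α β x y) (cong (λ D → α * x + D * (β * y) + (α * y + β * x)) (sym d≡)))
    (∣m∣n⇒∣m+n (∣m⇒∣m*n (x + y) 3∣) (∣m⇒∣m*n ((+ 8 * δ + + 3) * (β * y)) ∣-refl))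
    where
    φ-⊗ : ∀ δ α β x y → (α + β) * (x + y) + + 3 * ((+ 8 * δ + + 3) * (β * y)) ≡ α * x + (+ 24 * δ + + 10) * (β * y) + (α * y + β * x)
    φ-⊗ = solve-∀

  odd⇒≢𝟘 : (a : ℤ[√ d ]) → Odd (im a) → a ≢ 𝟘
  odd⇒≢𝟘 a odd a≡𝟘 = ℕ.<-irrefl refl (subst (λ x → 0 ℕ.< ∣ x ∣) (cong im a≡𝟘) (odd⇒0<∣x∣ odd))

  -- The factors are s = a ε u: as multiples of a they lie in its prime above 3, and ε gives them
  -- the opposite norm.
  largeSolutions-aligned₊ : ∀ M K → let m = + 4 * M + 1ℤ; k = + 2 * K + 1ℤ in
    + 3 ∣ (1ℤ - (m + k)) * (1ℤ - (m + k) + 1ℤ) → LargeSolutions {d} (target 1ℤ m k)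
  largeSolutions-aligned₊ M K 3∣u = go (aligned (- 1ℤ) (ξ ⊗ ε) norm-ξ⊗ε)
    where
    sol : ∀ α β p q → α * α - (+ 24 * δ + + 10) * (β * β) ≡ - + 6 → p * p - (+ 24 * δ + + 10) * (q * q) ≡ + 6 →
          (∃ λ A → α ≡ + 4 * A + + 2) × Odd β → (∃ λ P → p ≡ + 4 * P) × Odd q →
          + 3 ∣ α + β → + 3 ∣ p + q → Solution (α +√d· β) (target 1ℤ (+ 4 * M + 1ℤ) (+ 2 * K + 1ℤ)) (p +√d· q)
    sol _ _ _ _ Na N ((A , refl) , (B , refl)) ((P , refl) , (v , refl)) 3∣a 3∣s = mkSolution-aligned₊ δ d≡ A B P v M K Na N 3∣a 3∣s 3∣u
    go : (∃ λ (a : ℤ[√ d ]) → norm a ≡ - + 6 × + 3 ∣ re a + im a) → LargeSolutions (target 1ℤ (+ 4 * M + 1ℤ) (+ 2 * K + 1ℤ))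
    go (a , norm-a , 3∣a) = unitMultiples (a ⊗ ε) (trans (norm-⊗ a ε) (cong₂ _*_ norm-a norm-ε)) (s≤s z≤n)
      (odd⇒≢𝟘 a (proj₂ shape-a))
      λ u N → let s = a ⊗ ε ⊗ u; N′ = norm-expand s N in
        sol (re a) (im a) (re s) (im s) (norm-expand a norm-a) N′ shape-a (norm≡6⇒ δ (re s) (im s) N′) 3∣a (aligned-⊗ (a ⊗ ε) u (aligned-⊗ a ε 3∣a))
      where
      shape-a = norm≡-6⇒ δ (re a) (im a) (norm-expand a norm-a)

  largeSolutions-aligned₋ : ∀ M K → let m = + 4 * M + + 3; k = + 2 * K in
    + 3 ∣ (1ℤ - (m + k)) * (1ℤ - (m + k) + - 1ℤ) → LargeSolutions {d} (target (- 1ℤ) m k)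
  largeSolutions-aligned₋ M K 3∣u = go (aligned 1ℤ ξ norm-ξ)
    where
    sol : ∀ α β p q → α * α - (+ 24 * δ + + 10) * (β * β) ≡ + 6 → p * p - (+ 24 * δ + + 10) * (q * q) ≡ - + 6 →
          (∃ λ A → α ≡ + 4 * A) × Odd β → (∃ λ P → p ≡ + 4 * P + + 2) × Odd q →
          + 3 ∣ α + β → + 3 ∣ p + q → Solution (α +√d· β) (target (- 1ℤ) (+ 4 * M + + 3) (+ 2 * K)) (p +√d· q)
    sol _ _ _ _ Na N ((A , refl) , (B , refl)) ((P , refl) , (v , refl)) 3∣a 3∣s = mkSolution-aligned₋ δ d≡ A B P v M K Na N 3∣a 3∣s 3∣u
    go : (∃ λ (a : ℤ[√ d ]) → norm a ≡ + 6 × + 3 ∣ re a + im a) → LargeSolutions (target (- 1ℤ) (+ 4 * M + + 3) (+ 2 * K))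
    go (a , norm-a , 3∣a) = unitMultiples (a ⊗ ε) (trans (norm-⊗ a ε) (cong₂ _*_ norm-a norm-ε)) (s≤s z≤n)
      (odd⇒≢𝟘 a (proj₂ shape-a))
      λ u N → let s = a ⊗ ε ⊗ u; N′ = norm-expand s N in
        sol (re a) (im a) (re s) (im s) (norm-expand a norm-a) N′ shape-a (norm≡-6⇒ δ (re s) (im s) N′) 3∣a (aligned-⊗ (a ⊗ ε) u (aligned-⊗ a ε 3∣a))
      where
      shape-a = norm≡6⇒ δ (re a) (im a) (norm-expand a norm-a)

  -- One prime above 3 fails only if 3 ∣ m + k, the other only if 3 ∣ m - k; together these give 3 ∣
  -- m and 3 ∣ k.
  largeSolutions-1mod4 : ∀ M K → let m = + 4 * M + 1ℤ; k = + 2 * K + 1ℤ in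
    ¬ ((+ 3 ∣ m) × (+ 3 ∣ k)) → LargeSolutions {d} (target 1ℤ m k)
  largeSolutions-1mod4 M K 3∤ with + 3 ∣? + 4 * M + 1ℤ + (+ 2 * K + 1ℤ)
  ... | no 3∤m+k = largeSolutions-aligned₊ M K (∤⇒∣[1-j][2-j] (+ 4 * M + 1ℤ + (+ 2 * K + 1ℤ)) 3∤m+k)
  ... | yes 3∣m+k = subst LargeSolutions (ext refl (conj-eq K))
    (conj-LargeSolutions (largeSolutions-aligned₊ M (- K - 1ℤ) (∤⇒∣[1-j][2-j] (+ 4 * M + 1ℤ + (+ 2 * (- K - 1ℤ) + 1ℤ))
      (3∤ ∘ 3∣x±y⇒ (+ 4 * M + 1ℤ) (+ 2 * K + 1ℤ) 3∣m+k ∘ subst (+ 3 ∣_) (flip M K)))))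
    where
    conj-eq : ∀ K → - (1ℤ * (+ 4 * (+ 2 * (- K - 1ℤ) + 1ℤ))) ≡ 1ℤ * (+ 4 * (+ 2 * K + 1ℤ))
    conj-eq = solve-∀
    flip : ∀ M K → + 4 * M + 1ℤ + (+ 2 * (- K - 1ℤ) + 1ℤ) ≡ + 4 * M + 1ℤ - (+ 2 * K + 1ℤ)
    flip = solve-∀

  largeSolutions-0mod4 : ∀ M K → let m = + 4 * M + + 3; k = + 2 * K in
    ¬ ((+ 3 ∣ - 1ℤ - m) × (+ 3 ∣ k)) → LargeSolutions {d} (target (- 1ℤ) m k)
  largeSolutions-0mod4 M K 3∤ with + 3 ∣? - 1ℤ - (+ 4 * M + + 3 + + 2 * K)
  ... | no 3∤j = largeSolutions-aligned₋ M K (∤⇒∣[1-j]j (+ 4 * M + + 3 + + 2 * K) 3∤j)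
  ... | yes 3∣j = subst LargeSolutions (ext refl (conj-eq K))
    (conj-LargeSolutions (largeSolutions-aligned₋ M (- K) (∤⇒∣[1-j]j (+ 4 * M + + 3 + + 2 * - K)
      (λ 3∣j′ → 3∤ (3∣x±y⇒ (- 1ℤ - (+ 4 * M + + 3)) (+ 2 * K) (subst (+ 3 ∣_) (plus M K) 3∣j′) (subst (+ 3 ∣_) (minus M K) 3∣j))))))
    where
    conj-eq : ∀ K → - (- 1ℤ * (+ 4 * (+ 2 * - K))) ≡ - 1ℤ * (+ 4 * (+ 2 * K))
    conj-eq = solve-∀
    plus : ∀ M K → - 1ℤ - (+ 4 * M + + 3 + + 2 * - K) ≡ - 1ℤ - (+ 4 * M + + 3) + + 2 * K
    plus = solve-∀
    minus : ∀ M K → - 1ℤ - (+ 4 * M + + 3 + + 2 * K) ≡ - 1ℤ - (+ 4 * M + + 3) - + 2 * K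
    minus = solve-∀

  private
    [4m+2]+[4k]√d : ℤ → ℤ → ℤ[√ d ]
    [4m+2]+[4k]√d m k = + 4 * m + + 2 +√d· + 4 * k

  fromTarget₊ : ∀ m k → LargeSolutions {d} (target 1ℤ m k) → LargeSolutions ([4m+2]+[4k]√d m k)
  fromTarget₊ m k = subst LargeSolutions (ext (ℤ.*-identityˡ (+ 4 * m + + 2)) (ℤ.*-identityˡ (+ 4 * k)))

  fromTarget₋ : ∀ m k {M K} → M ≡ - m - 1ℤ → K ≡ - k → LargeSolutions {d} (target (- 1ℤ) M K) → LargeSolutions ([4m+2]+[4k]√d m k)
  fromTarget₋ m k refl refl = subst LargeSolutions (ext (re-eq m) (im-eq k))
    where
    re-eq : ∀ m → - 1ℤ * (+ 4 * (- m - 1ℤ) + + 2) ≡ + 4 * m + + 2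
    re-eq = solve-∀
    im-eq : ∀ k → - 1ℤ * (+ 4 * - k) ≡ + 4 * k
    im-eq = solve-∀

  -- The sign e = 1 serves m even with k odd, m ≡ 2 modulo 4 with k even, and m ≡ 1 modulo 4 with k
  -- odd; e = -1 serves the remaining classes.
  largeSolutions : ∀ m k → ¬ (m ≡ + 9 [mod 12 ] × k ≡ + 3 [mod 6 ]) → ¬ (m ≡ + 0 [mod 12 ] × k ≡ + 0 [mod 6 ]) →
                   LargeSolutions ([4m+2]+[4k]√d m k)
  largeSolutions m k ≢9,3 ≢0,0 with parity m | parity k
  ... | inj₁ (a , refl) | inj₂ (b , refl) =
    fromTarget₊ (+ 2 * a) (+ 2 * b + 1ℤ) (largeSolutions₊ (λ ()) λ P v → mkSolution-2₊ δ d≡ P v a b)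
  ... | inj₂ (a , refl) | inj₁ (b , refl) =
    fromTarget₋ (+ 2 * a + 1ℤ) (+ 2 * b) (M-eq a) (K-eq b) (largeSolutions₋ (λ ()) λ P v → mkSolution-2₋ δ d≡ P v (- a - 1ℤ) (- b))
    where
    M-eq : ∀ a → + 2 * (- a - 1ℤ) ≡ - (+ 2 * a + 1ℤ) - 1ℤ
    M-eq = solve-∀
    K-eq : ∀ b → + 2 * - b ≡ - (+ 2 * b)
    K-eq = solve-∀
  ... | inj₁ (a , refl) | inj₁ (b , refl) with parity a
  ...   | inj₂ (c , refl) = subst (λ m → LargeSolutions ([4m+2]+[4k]√d m (+ 2 * b))) (m-eq c)
    (fromTarget₊ (+ 4 * c + + 2) (+ 2 * b) (largeSolutions₊ (λ ()) λ P v → mkSolution-4₊ δ d≡ P v c b))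
    where
    m-eq : ∀ c → + 4 * c + + 2 ≡ + 2 * (+ 2 * c + 1ℤ)
    m-eq = solve-∀
  ...   | inj₁ (c , refl) = fromTarget₋ (+ 2 * (+ 2 * c)) (+ 2 * b) (M-eq c) (K-eq b) (largeSolutions-0mod4 (- c - 1ℤ) (- b) excluded)
    where
    M-eq : ∀ c → + 4 * (- c - 1ℤ) + + 3 ≡ - (+ 2 * (+ 2 * c)) - 1ℤ
    M-eq = solve-∀
    K-eq : ∀ b → + 2 * - b ≡ - (+ 2 * b)
    K-eq = solve-∀
    excluded : ¬ ((+ 3 ∣ - 1ℤ - (+ 4 * (- c - 1ℤ) + + 3)) × (+ 3 ∣ + 2 * - b))
    excluded (divides s s≡ , divides t t≡) = ≢0,0
      -- The moduli are merged through m = 4 m - 3 m, where 3 ∣ m and 4 ∣ m, and k = 3 k - 2 k,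
      -- where 2 ∣ k and 3 ∣ k.
      ( divides (s - c) (trans (m-split c) (trans (cong (λ x → + 4 * x - + 12 * c) s≡) (m-join c s)))
      , divides (b + t) (trans (k-split b) (trans (cong (λ x → + 6 * b + + 2 * x) t≡) (k-join b t))))
      where
      m-split : ∀ c → + 2 * (+ 2 * c) - + 0 ≡ + 4 * (- 1ℤ - (+ 4 * (- c - 1ℤ) + + 3)) - + 12 * c
      m-split = solve-∀
      m-join : ∀ c s → + 4 * (s * + 3) - + 12 * c ≡ (s - c) * + 12
      m-join = solve-∀
      k-split : ∀ b → + 2 * b - + 0 ≡ + 6 * b + + 2 * (+ 2 * - b)
      k-split = solve-∀
      k-join : ∀ b t → + 6 * b + + 2 * (t * + 3) ≡ (b + t) * + 6
      k-join = solve-∀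
  largeSolutions m k ≢9,3 ≢0,0 | inj₂ (a , refl) | inj₂ (b , refl) with parity a
  ... | inj₂ (c , refl) = fromTarget₋ (+ 2 * (+ 2 * c + 1ℤ) + 1ℤ) (+ 2 * b + 1ℤ) (M-eq c) (K-eq b)
    (largeSolutions₋ (λ ()) λ P v → mkSolution-4₋ δ d≡ P v (- c - 1ℤ) (- b - 1ℤ))
    where
    M-eq : ∀ c → + 4 * (- c - 1ℤ) ≡ - (+ 2 * (+ 2 * c + 1ℤ) + 1ℤ) - 1ℤ
    M-eq = solve-∀
    K-eq : ∀ b → + 2 * (- b - 1ℤ) + 1ℤ ≡ - (+ 2 * b + 1ℤ)
    K-eq = solve-∀
  ... | inj₁ (c , refl) = subst (λ m → LargeSolutions ([4m+2]+[4k]√d m (+ 2 * b + 1ℤ))) (m-eq c)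
    (fromTarget₊ (+ 4 * c + 1ℤ) (+ 2 * b + 1ℤ) (largeSolutions-1mod4 c b excluded))
    where
    m-eq : ∀ c → + 4 * c + 1ℤ ≡ + 2 * (+ 2 * c) + 1ℤ
    m-eq = solve-∀
    excluded : ¬ ((+ 3 ∣ + 4 * c + 1ℤ) × (+ 3 ∣ + 2 * b + 1ℤ))
    excluded (divides s s≡ , divides t t≡) = ≢9,3
      ( divides (s - c - 1ℤ) (trans (m-split c) (trans (cong (λ x → + 4 * x - + 12 * c - + 12) s≡) (m-join c s)))
      , divides (b - t) (trans (k-split b) (trans (cong (λ x → + 6 * b - + 2 * x) t≡) (k-join b t))))
      where
      m-split : ∀ c → + 2 * (+ 2 * c) + 1ℤ - + 9 ≡ + 4 * (+ 4 * c + 1ℤ) - + 12 * c - + 12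
      m-split = solve-∀
      m-join : ∀ c s → + 4 * (s * + 3) - + 12 * c - + 12 ≡ (s - c - 1ℤ) * + 12
      m-join = solve-∀
      k-split : ∀ b → + 2 * b + 1ℤ - + 3 ≡ + 6 * b - + 2 * (+ 2 * b + 1ℤ)
      k-split = solve-∀
      k-join : ∀ b t → + 6 * b - + 2 * (t * + 3) ≡ (b - t) * + 6
      k-join = solve-∀

theorem1p3 : (d : ℕ) → 0 ℕ.< d → SquareFree d → + d ≡ + 2 [mod 4 ] →
    (∃₂ λ (x y : ℤ) → x ^ 2 - (+ d) * y ^ 2 ≡ - (+ 1)) →
    (∃₂ λ (x y : ℤ) → x ^ 2 - (+ d) * y ^ 2 ≡ + 6) →
    (m k : ℤ) →
    ¬ (m ≡ + 9 [mod 12 ] × k ≡ + 3 [mod 6 ]) →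
    ¬ (m ≡ + 0 [mod 12 ] × k ≡ + 0 [mod 6 ]) →
    Infinite (DQuadrupleSetoid {d} ((+ 4) * m + (+ 2) +√d· (+ 4) * k))
theorem1p3 d 0<d _ (divides D d-2≡) (x , y , pell) (p , q , six) m k ≢9,3 ≢0,0 =
  -- d = 4 D + 2 is refined to 8 g + 2 by the equation with -1, and to 24 δ + 10 by both equations.
  let d≡4D+2 = trans (add-sub (+ d)) (trans (cong (λ t → t + + 2) d-2≡) (cong (λ t → t + + 2) (ℤ.*-comm D (+ 4))))
      pell′ = trans (sym (squares (+ d) x y)) pell
      six′ = trans (sym (squares (+ d) p q)) six
      (g , D≡2g) , x-odd , y-odd = negativePell⇒ D x y (subst (λ t → x * x - t * (y * y) ≡ - 1ℤ) d≡4D+2 pell′)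
      d≡8g+2 = trans d≡4D+2 (trans (cong (λ t → + 4 * t + + 2) D≡2g) (eight g))
      δ , 8g+2≡ = 10mod24 g x y p q (subst (λ t → x * x - t * (y * y) ≡ - 1ℤ) d≡8g+2 pell′) (subst (λ t → p * p - t * (q * q) ≡ + 6) d≡8g+2 six′)
      a , a≢𝟘 , large = largeSolutions 0<d δ (trans d≡8g+2 8g+2≡) (x +√d· y) (p +√d· q) pell′
                          (odd⇒0<∣x∣ x-odd) (odd⇒0<∣x∣ y-odd) six′ m k ≢9,3 ≢0,0
  in solutions⇒infinite 0<d a≢𝟘 large
  where
  add-sub : ∀ d → d ≡ d - + 2 + + 2
  add-sub = solve-∀
  eight : ∀ g → + 4 * (+ 2 * g) + + 2 ≡ + 8 * g + + 2
  eight = solve-∀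
  square : ∀ x → x ^ 2 ≡ x * x
  square x = cong (x *_) (ℤ.*-identityʳ x)
  squares : ∀ d x y → x ^ 2 - d * y ^ 2 ≡ x * x - d * (y * y)
  squares d x y = cong₂ (λ s t → s - d * t) (square x) (square y)
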